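{- For a positive integer $n$, let $A$ and $B$ be independent random $n$-sided dice in the balanced sequences model. Then the probability that $A$ ties with $B$ is $o(1)$ as $n\to\infty$.
   Context: An $n$-sided die in the balanced sequences model is a sequence $(a_1,\dots,a_n)\in\{1,2,\dots,n\}^n$ with $\sum_i a_i=n(n+1)/2$; a random $n$-sided die is such a sequence chosen uniformly at random. For dice $A=(a_1,\dots,a_n)$ and $B=(b_1,\dots,b_n)$, $A$ beats $B$ if the number of pairs $(i,j)$ with $a_i>b_j$ is greater than the number of pairs $(i,j)$ with $a_i<b_j$; $A$ ties with $B$ if these two numbers are equal. -}

module Defs where

open import Data.Nat using (ℕ; zero; suc; _+_; _*_; _<_; _<?_; _≟_)
open import Data.List using (List; []; _∷_; map; concatMap; applyUpTo; length; filter; cartesianProduct)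
open import Data.Nat.ListAction using (sum)
open import Data.Product using (_×_; _,_; proj₁; proj₂)
open import Relation.Binary.PropositionalEquality using (_≡_)
open import Relation.Nullary using (Dec)

sequences : ℕ → ℕ → List (List ℕ)
sequences m zero    = [] ∷ []
sequences m (suc k) = concatMap (λ a → map (a ∷_) (sequences m k)) (applyUpTo suc m)

-- Balanced-sequences model: sequences in {1..n}^n with sum n(n+1)/2
-- (stated as 2 * sum ≡ n * (n + 1) to avoid division).
balanced? : (n : ℕ) → (s : List ℕ) → Dec (2 * sum s ≡ n * (n + 1))
balanced? n s = 2 * sum s ≟ n * (n + 1)

dice : ℕ → List (List ℕ)
dice n = filter (balanced? n) (sequences n n)

wins : List ℕ → List ℕ → ℕ
wins A B = length (filter (λ p → proj₂ p <? proj₁ p) (cartesianProduct A B))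

ties? : (p : List ℕ × List ℕ) → Dec (wins (proj₁ p) (proj₂ p) ≡ wins (proj₂ p) (proj₁ p))
ties? (A , B) = wins A B ≟ wins B A

tieCount : ℕ → ℕ
tieCount n = length (filter ties? (cartesianProduct (dice n) (dice n)))

diceCount : ℕ → ℕ
diceCount n = length (dice n)

{-# OPTIONS --safe #-}

-- Write score A b = #{a < b} + #{a ≤ b}. If A ties with B then Σ_b score A b = n², so a tie pins a
-- sum of a fixed weight over the entries of B. Exchanging (x , d + y) for (d + x , y) in two
-- consecutive entries of B keeps the sum of B; call (x , y) active if it changes the weight.
--
-- If a positive proportion of the (x , y) is active for a weight G, then the G-weight of a random die
-- is not concentrated. Count, over pairs of coordinates, the hits of a set of r targets. At an active
-- pair the two exchanged states see two translates of the set, and the largest target of one of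
-- them can be moved to the other, giving sets of sizes r + 1 and r - 1. As r ↦ r / K is harmonic
-- for this walk on 0, …, K, one target is hit with probability at most 1 / K, up to the
-- exponentially small probability that the walk has not stopped. Exponentially small
-- errors are harmless because at least n^n / poly(n) sequences are balanced: by the symmetry
-- b ↦ n + 1 - b and Cauchy-Schwarz.
--
-- This is used twice. For fixed (x , y) in suitable quarters of [1, d]², with d = 4 ⌊n/8⌋, being
-- inactive for score A is again an event pinning a weight over the entries of A, and this weight
-- visibly has many active pairs; hence all but few A have many active pairs. For those A the
-- weight score A is not concentrated over B.
module Submission where

open import Defs
open import Algebra.Properties.CommutativeSemigroup using (interchange)
open import Data.Bool using (if_then_else_; true; false)
open import Data.List using (List; []; _∷_; _++_; map; concatMap; applyUpTo; length; filter; cartesianProduct)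
open import Data.List.Properties using (length-applyUpTo; length-map)
open import Data.List.Relation.Unary.All using (All; []; _∷_)
import Data.List.Relation.Unary.All as All
import Data.List.Relation.Unary.All.Properties as Allₚ
open import Data.List.Relation.Unary.AllPairs using (AllPairs; []; _∷_)
import Data.List.Relation.Unary.AllPairs as AllPairs
import Data.List.Relation.Unary.AllPairs.Properties as AllPairsₚ
open import Data.Nat
open import Data.Nat.DivMod using (_/_; _%_; m≡m%n+[m/n]*n; m%n<n; /-monoˡ-≤; m*n/n≡m)
open import Data.Nat.ListAction using (sum)
open import Data.Nat.Properties
open import Data.Nat.Tactic.RingSolver using (solve-∀)
open import Data.Product using (_×_; _,_; proj₁; proj₂; ∃-syntax)
open import Data.Sum using (_⊎_; inj₁; inj₂; [_,_]′)
open import Function using (_∘_)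
open import Relation.Binary.Definitions using (Tri; tri<; tri≈; tri>)
open import Relation.Binary.PropositionalEquality
open import Relation.Nullary using (Dec; yes; no; ¬_; does; ¬?; contradiction)

+-interchange : ∀ a b c d → (a + b) + (c + d) ≡ (a + c) + (b + d)
+-interchange = interchange +-commutativeSemigroup

-- Finite sums

variable
  X Y : Set
  P Q : Set

⟦_⟧ : Dec P → ℕ
⟦ P? ⟧ = if does P? then 1 else 0

⟦⟧-true : (P? : Dec P) → P → ⟦ P? ⟧ ≡ 1
⟦⟧-true (yes _) _ = refl
⟦⟧-true (no ¬p) p = contradiction p ¬p

⟦⟧-false : (P? : Dec P) → ¬ P → ⟦ P? ⟧ ≡ 0
⟦⟧-false (yes p) ¬p = contradiction p ¬p
⟦⟧-false (no _)  _  = refl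

⟦⟧≤1 : (P? : Dec P) → ⟦ P? ⟧ ≤ 1
⟦⟧≤1 (yes _) = ≤-refl
⟦⟧≤1 (no _)  = z≤n

⟦⟧-mono : (P? : Dec P) (Q? : Dec Q) → (P → Q) → ⟦ P? ⟧ ≤ ⟦ Q? ⟧
⟦⟧-mono (yes p) Q? f = ≤-reflexive (sym (⟦⟧-true Q? (f p)))
⟦⟧-mono (no _)  Q? f = z≤n

⟦⟧-¬ : (P? : Dec P) → ⟦ P? ⟧ + ⟦ ¬? P? ⟧ ≡ 1
⟦⟧-¬ (yes _) = refl
⟦⟧-¬ (no _)  = refl

sumOver : List X → (X → ℕ) → ℕ
sumOver []       f = 0
sumOver (x ∷ xs) f = f x + sumOver xs f

infix 5 sumOver
syntax sumOver xs (λ x → e) = ∑[ x ∈ xs ] e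

sumOver-cong : (xs : List X) {f g : X → ℕ} → (∀ x → f x ≡ g x) → sumOver xs f ≡ sumOver xs g
sumOver-cong []       f≡g = refl
sumOver-cong (x ∷ xs) f≡g = cong₂ _+_ (f≡g x) (sumOver-cong xs f≡g)

-- Asks for the inequality only on the entries of the list, so that range and length information
-- from `interval-bounds`, `sequences-valid` or `dice-valid` can be used inside a sum.
sumOver-monoᴬ : {f g : X → ℕ} {xs : List X} → All (λ x → f x ≤ g x) xs → sumOver xs f ≤ sumOver xs g
sumOver-monoᴬ []         = z≤n
sumOver-monoᴬ (fx≤gx ∷ h) = +-mono-≤ fx≤gx (sumOver-monoᴬ h)

sumOver-mono : (xs : List X) {f g : X → ℕ} → (∀ x → f x ≤ g x) → sumOver xs f ≤ sumOver xs g
sumOver-mono xs f≤g = sumOver-monoᴬ (All.universal f≤g xs)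

sumOver-+ : (xs : List X) (f g : X → ℕ) → (∑[ x ∈ xs ] (f x + g x)) ≡ sumOver xs f + sumOver xs g
sumOver-+ []       f g = refl
sumOver-+ (x ∷ xs) f g rewrite sumOver-+ xs f g = +-interchange (f x) (g x) (sumOver xs f) (sumOver xs g)

sumOver-*ˡ : (xs : List X) (c : ℕ) (f : X → ℕ) → (∑[ x ∈ xs ] c * f x) ≡ c * sumOver xs f
sumOver-*ˡ []       c f = sym (*-zeroʳ c)
sumOver-*ˡ (x ∷ xs) c f rewrite sumOver-*ˡ xs c f = sym (*-distribˡ-+ c (f x) (sumOver xs f))

sumOver-*ʳ : (xs : List X) (c : ℕ) (f : X → ℕ) → (∑[ x ∈ xs ] f x * c) ≡ sumOver xs f * c
sumOver-*ʳ xs c f = trans (sumOver-cong xs (λ x → *-comm (f x) c))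
                          (trans (sumOver-*ˡ xs c f) (*-comm c (sumOver xs f)))

sumOver-const : (xs : List X) (c : ℕ) → (∑[ x ∈ xs ] c) ≡ length xs * c
sumOver-const []       c = refl
sumOver-const (x ∷ xs) c = cong (c +_) (sumOver-const xs c)

sumOver-++ : (xs ys : List X) (f : X → ℕ) → sumOver (xs ++ ys) f ≡ sumOver xs f + sumOver ys f
sumOver-++ []       ys f = refl
sumOver-++ (x ∷ xs) ys f rewrite sumOver-++ xs ys f = sym (+-assoc (f x) _ _)

sumOver-map : (h : X → Y) (xs : List X) (f : Y → ℕ) → sumOver (map h xs) f ≡ sumOver xs (f ∘ h)
sumOver-map h []       f = refl
sumOver-map h (x ∷ xs) f = cong (f (h x) +_) (sumOver-map h xs f)

sumOver-concatMap : (h : X → List Y) (xs : List X) (f : Y → ℕ) →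
  sumOver (concatMap h xs) f ≡ (∑[ x ∈ xs ] sumOver (h x) f)
sumOver-concatMap h []       f = refl
sumOver-concatMap h (x ∷ xs) f =
  trans (sumOver-++ (h x) _ f) (cong (sumOver (h x) f +_) (sumOver-concatMap h xs f))

sumOver-swap : (xs : List X) (ys : List Y) (f : X → Y → ℕ) →
  (∑[ x ∈ xs ] ∑[ y ∈ ys ] f x y) ≡ (∑[ y ∈ ys ] ∑[ x ∈ xs ] f x y)
sumOver-swap []       ys f = sym (trans (sumOver-const ys 0) (*-zeroʳ (length ys)))
sumOver-swap (x ∷ xs) ys f =
  trans (cong (sumOver ys (f x) +_) (sumOver-swap xs ys f)) (sym (sumOver-+ ys (f x) _))

sumOver-cartesianProduct : (xs : List X) (ys : List Y) (f : X × Y → ℕ) →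
  sumOver (cartesianProduct xs ys) f ≡ (∑[ x ∈ xs ] ∑[ y ∈ ys ] f (x , y))
sumOver-cartesianProduct []       ys f = refl
sumOver-cartesianProduct (x ∷ xs) ys f =
  trans (sumOver-++ (map (x ,_) ys) _ f)
        (cong₂ _+_ (sumOver-map (x ,_) ys f) (sumOver-cartesianProduct xs ys f))

module _ {R : X → Set} (R? : ∀ x → Dec (R x)) where

  sumOver-filter : (xs : List X) (f : X → ℕ) → sumOver (filter R? xs) f ≡ (∑[ x ∈ xs ] ⟦ R? x ⟧ * f x)
  sumOver-filter []       f = refl
  sumOver-filter (x ∷ xs) f with does (R? x)
  ... | false = sumOver-filter xs f
  ... | true  = cong₂ _+_ (sym (+-identityʳ (f x))) (sumOver-filter xs f)

  length-filter-sumOver : (xs : List X) → length (filter R? xs) ≡ (∑[ x ∈ xs ] ⟦ R? x ⟧)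
  length-filter-sumOver []       = refl
  length-filter-sumOver (x ∷ xs) with does (R? x)
  ... | false = length-filter-sumOver xs
  ... | true  = cong suc (length-filter-sumOver xs)

-- The values c + 1, …, c + e.
interval : ℕ → ℕ → List ℕ
interval c e = applyUpTo (λ i → suc (c + i)) e

length-interval : ∀ c e → length (interval c e) ≡ e
length-interval c e = length-applyUpTo _ e

applyUpTo-cong : {f g : ℕ → X} → (∀ i → f i ≡ g i) → ∀ n → applyUpTo f n ≡ applyUpTo g n
applyUpTo-cong f≡g zero    = refl
applyUpTo-cong f≡g (suc n) = cong₂ _∷_ (f≡g 0) (applyUpTo-cong (f≡g ∘ suc) n)

sumOver-applyUpTo-+ : (h : ℕ → X) (a b : ℕ) (f : X → ℕ) →
  sumOver (applyUpTo h (a + b)) f ≡ sumOver (applyUpTo h a) f + sumOver (applyUpTo (λ i → h (a + i)) b) f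
sumOver-applyUpTo-+ h zero    b f = refl
sumOver-applyUpTo-+ h (suc a) b f =
  trans (cong (f (h 0) +_) (sumOver-applyUpTo-+ (h ∘ suc) a b f)) (sym (+-assoc (f (h 0)) _ _))

sumOver-interval-+ : ∀ c a b (f : ℕ → ℕ) →
  sumOver (interval c (a + b)) f ≡ sumOver (interval c a) f + sumOver (interval (c + a) b) f
sumOver-interval-+ c a b f = trans (sumOver-applyUpTo-+ (λ i → suc (c + i)) a b f)
  (cong (λ l → sumOver (interval c a) f + sumOver l f)
        (applyUpTo-cong (λ i → cong suc (sym (+-assoc c a i))) b))

sumOver-interval-shift : ∀ d c e (f : ℕ → ℕ) →
  sumOver (interval (d + c) e) f ≡ (∑[ x ∈ interval c e ] f (d + x))
sumOver-interval-shift d c e f = go (λ i → suc ((d + c) + i)) (λ i → suc (c + i)) (λ i → lemma d c i) e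
  where
  lemma : ∀ d c i → suc ((d + c) + i) ≡ d + suc (c + i)
  lemma = solve-∀
  go : (h k : ℕ → ℕ) → (∀ i → h i ≡ d + k i) → ∀ e →
    sumOver (applyUpTo h e) f ≡ (∑[ x ∈ applyUpTo k e ] f (d + x))
  go h k eq zero    = refl
  go h k eq (suc e) = cong₂ _+_ (cong f (eq 0)) (go (h ∘ suc) (k ∘ suc) (eq ∘ suc) e)

sumOver-interval-⊆ : ∀ c a e b (f : ℕ → ℕ) → sumOver (interval (c + a) e) f ≤ sumOver (interval c (a + (e + b))) f
sumOver-interval-⊆ c a e b f rewrite sumOver-interval-+ c a (e + b) f | sumOver-interval-+ (c + a) e b f =
  m≤n⇒m≤o+n (sumOver (interval c a) f) (m≤m+n (sumOver (interval (c + a) e) f) _)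

interval-bounds : ∀ c e → All (λ x → c < x × x ≤ c + e) (interval c e)
interval-bounds c e = Allₚ.applyUpTo⁺₁ _ e
  (λ {i} i<e → s≤s (m≤m+n c i) , ≤-trans (≤-reflexive (sym (+-suc c i))) (+-monoʳ-≤ c i<e))

sumOver-reverse : ∀ n (f : ℕ → ℕ) → sumOver (interval 0 n) f ≡ (∑[ b ∈ interval 0 n ] f (suc n ∸ b))
sumOver-reverse zero    f = refl
sumOver-reverse (suc n) f = begin
  sumOver (interval 0 (suc n)) f                         ≡⟨ cong (f 1 +_) (sumOver-interval-shift 1 0 n f) ⟩
  f 1 + (∑[ b ∈ interval 0 n ] f (suc b))                 ≡⟨ cong (f 1 +_) (sumOver-reverse n (f ∘ suc)) ⟩
  f 1 + (∑[ b ∈ interval 0 n ] f (suc (suc n ∸ b)))       ≡⟨ +-comm (f 1) _ ⟩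
  (∑[ b ∈ interval 0 n ] f (suc (suc n ∸ b))) + f 1       ≡⟨ cong₂ _+_ inner (cong f (sym (m+n∸n≡m 1 n))) ⟩
  (∑[ b ∈ interval 0 n ] f (suc (suc n) ∸ b)) + f (suc (suc n) ∸ suc n) ≡⟨ cong (outer +_) (sym (+-identityʳ _)) ⟩
  outer + (f (suc (suc n) ∸ suc n) + 0)
    ≡⟨ cong (λ k → outer + (f (suc (suc n) ∸ suc k) + 0)) (sym (+-identityʳ n)) ⟩
  outer + (∑[ b ∈ interval n 1 ] f (suc (suc n) ∸ b))      ≡⟨ sym (sumOver-interval-+ 0 n 1 _) ⟩
  (∑[ b ∈ interval 0 (n + 1) ] f (suc (suc n) ∸ b))
    ≡⟨ cong (λ m → ∑[ b ∈ interval 0 m ] f (suc (suc n) ∸ b)) (+-comm n 1) ⟩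
  (∑[ b ∈ interval 0 (suc n) ] f (suc (suc n) ∸ b))       ∎
  where
  open ≡-Reasoning
  outer = ∑[ b ∈ interval 0 n ] f (suc (suc n) ∸ b)
  -- Truncated subtraction commutes with `suc` only for `b ≤ suc n`. The pointwise equality is
  -- therefore known on the interval alone and enters through two comparisons.
  inner : (∑[ b ∈ interval 0 n ] f (suc (suc n ∸ b))) ≡ outer
  inner = ≤-antisym
    (sumOver-monoᴬ (All.map (λ (_ , b≤n) → ≤-reflexive (cong f (sym (+-∸-assoc 1 (m≤n⇒m≤1+n b≤n)))))
                            (interval-bounds 0 n)))
    (sumOver-monoᴬ (All.map (λ (_ , b≤n) → ≤-reflexive (cong f (+-∸-assoc 1 (m≤n⇒m≤1+n b≤n)))) (interval-bounds 0 n)))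

-- Sums over sequences and the number of dice

sumOver-sequences-suc : ∀ n k (f : List ℕ → ℕ) →
  sumOver (sequences n (suc k)) f ≡ (∑[ b ∈ interval 0 n ] ∑[ B ∈ sequences n k ] f (b ∷ B))
sumOver-sequences-suc n k f = trans (sumOver-concatMap _ (interval 0 n) f)
  (sumOver-cong (interval 0 n) (λ b → sumOver-map (b ∷_) (sequences n k) f))

sumOver-sequences-+ : ∀ n k l (f : ℕ → ℕ) →
  (∑[ B ∈ sequences n (k + l) ] f (sum B)) ≡ (∑[ B ∈ sequences n k ] ∑[ C ∈ sequences n l ] f (sum B + sum C))
sumOver-sequences-+ n zero    l f = sym (+-identityʳ _)
sumOver-sequences-+ n (suc k) l f = begin
  (∑[ B ∈ sequences n (suc k + l) ] f (sum B))
    ≡⟨ sumOver-sequences-suc n (k + l) _ ⟩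
  (∑[ b ∈ interval 0 n ] ∑[ B ∈ sequences n (k + l) ] f (b + sum B))
    ≡⟨ sumOver-cong (interval 0 n) (λ b → sumOver-sequences-+ n k l (λ σ → f (b + σ))) ⟩
  (∑[ b ∈ interval 0 n ] ∑[ B ∈ sequences n k ] ∑[ C ∈ sequences n l ] f (b + (sum B + sum C)))
    ≡⟨ sumOver-cong (interval 0 n) (λ b → sumOver-cong (sequences n k) (λ B → sumOver-cong (sequences n l)
         (λ C → cong f (sym (+-assoc b (sum B) (sum C)))))) ⟩
  (∑[ b ∈ interval 0 n ] ∑[ B ∈ sequences n k ] ∑[ C ∈ sequences n l ] f ((b + sum B) + sum C))
    ≡⟨ sumOver-sequences-suc n k _ ⟨
  (∑[ B ∈ sequences n (suc k) ] ∑[ C ∈ sequences n l ] f (sum B + sum C)) ∎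
  where open ≡-Reasoning

sequences-valid : ∀ n k → All (λ B → length B ≡ k × All (_≤ n) B) (sequences n k)
sequences-valid n zero    = (refl , []) ∷ []
sequences-valid n (suc k) = Allₚ.concat⁺ (Allₚ.map⁺ (All.map extend (interval-bounds 0 n)))
  where
  extend : ∀ {b} → 0 < b × b ≤ n → All (λ B → length B ≡ suc k × All (_≤ n) B) (map (b ∷_) (sequences n k))
  extend (_ , b≤n) = Allₚ.map⁺ (All.map (λ (len , B≤n) → cong suc len , b≤n ∷ B≤n) (sequences-valid n k))

length-sequences : ∀ n k → length (sequences n k) ≡ n ^ k
length-sequences n k = trans (length-∑1 (sequences n k)) (go k)
  where
  length-∑1 : (xs : List X) → length xs ≡ (∑[ x ∈ xs ] 1)
  length-∑1 xs = sym (trans (sumOver-const xs 1) (*-identityʳ _))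
  go : ∀ k → (∑[ B ∈ sequences n k ] 1) ≡ n ^ k
  go zero    = refl
  go (suc k) = begin
    (∑[ B ∈ sequences n (suc k) ] 1)                      ≡⟨ sumOver-sequences-suc n k _ ⟩
    (∑[ b ∈ interval 0 n ] ∑[ B ∈ sequences n k ] 1)       ≡⟨ sumOver-cong (interval 0 n) (λ b → go k) ⟩
    (∑[ b ∈ interval 0 n ] n ^ k)                         ≡⟨ sumOver-const (interval 0 n) (n ^ k) ⟩
    length (interval 0 n) * n ^ k                        ≡⟨ cong (_* n ^ k) (length-interval 0 n) ⟩
    n * n ^ k                                            ∎
    where open ≡-Reasoning

module _ (n : ℕ) where

  cosum : List ℕ → ℕ
  cosum B = sum (map (suc n ∸_) B)

  sum+cosum : ∀ {B} → All (_≤ n) B → sum B + cosum B ≡ length B * suc n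
  sum+cosum []                  = refl
  sum+cosum {b ∷ B} (b≤n ∷ B≤n) = begin
    (b + sum B) + ((suc n ∸ b) + cosum B) ≡⟨ +-interchange b (sum B) (suc n ∸ b) (cosum B) ⟩
    (b + (suc n ∸ b)) + (sum B + cosum B) ≡⟨ cong₂ _+_ (m+[n∸m]≡n (m≤n⇒m≤1+n b≤n)) (sum+cosum B≤n) ⟩
    suc n + length B * suc n              ∎
    where open ≡-Reasoning

  sum≤ : ∀ {B} → All (_≤ n) B → sum B ≤ length B * n
  sum≤ []          = z≤n
  sum≤ (b≤n ∷ B≤n) = +-mono-≤ b≤n (sum≤ B≤n)

  -- Reflecting every coordinate by `b ↦ n + 1 - b` permutes the sequences; the induction applies
  -- `sumOver-reverse` to one coordinate at a time.
  sumOver-cosum : ∀ k (f : ℕ → ℕ) → (∑[ B ∈ sequences n k ] f (sum B)) ≡ (∑[ B ∈ sequences n k ] f (cosum B))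
  sumOver-cosum zero    f = refl
  sumOver-cosum (suc k) f = begin
    (∑[ B ∈ sequences n (suc k) ] f (sum B))
      ≡⟨ sumOver-sequences-suc n k _ ⟩
    (∑[ b ∈ interval 0 n ] ∑[ B ∈ sequences n k ] f (b + sum B))
      ≡⟨ sumOver-cong (interval 0 n) (λ b → sumOver-cosum k (λ σ → f (b + σ))) ⟩
    (∑[ b ∈ interval 0 n ] ∑[ B ∈ sequences n k ] f (b + cosum B))
      ≡⟨ sumOver-reverse n _ ⟩
    (∑[ b ∈ interval 0 n ] ∑[ B ∈ sequences n k ] f ((suc n ∸ b) + cosum B))
      ≡⟨ sumOver-sequences-suc n k _ ⟨
    (∑[ B ∈ sequences n (suc k) ] f (cosum B)) ∎
    where open ≡-Reasoning

-- Cauchy-Schwarz, collisions and central sums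

2ab≤a²+b² : ∀ a b → a * b + a * b ≤ a * a + b * b
2ab≤a²+b² a b with ≤-total a b
-- The two sides differ by the square of the difference of `a` and `b`, which is a natural number
-- once the larger one is written as the smaller plus a remainder.
... | inj₁ a≤b rewrite sym (m+[n∸m]≡n a≤b) = ≤-trans (m≤m+n _ ((b ∸ a) * (b ∸ a))) (≤-reflexive (expand a (b ∸ a)))
  where
  expand : ∀ a d → a * (a + d) + a * (a + d) + d * d ≡ a * a + (a + d) * (a + d)
  expand = solve-∀
... | inj₂ b≤a rewrite sym (m+[n∸m]≡n b≤a) = ≤-trans (m≤m+n _ ((a ∸ b) * (a ∸ b))) (≤-reflexive (expand b (a ∸ b)))
  where
  expand : ∀ b d → (b + d) * b + (b + d) * b + d * d ≡ (b + d) * (b + d) + b * b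
  expand = solve-∀

-- Sum `2ab≤a²+b²` over all pairs of entries: the left side becomes twice the squared sum, the right
-- side twice the length times the sum of squares.
cauchy-schwarz : (xs : List X) (f : X → ℕ) →
  sumOver xs f * sumOver xs f ≤ length xs * (∑[ x ∈ xs ] f x * f x)
cauchy-schwarz xs f = *-cancelˡ-≤ 2 (begin
  2 * (S * S)                                                 ≡⟨ cong ((S * S) +_) (+-identityʳ (S * S)) ⟩
  S * S + S * S                                               ≡⟨ cong₂ _+_ product product ⟨
  (∑[ x ∈ xs ] ∑[ y ∈ xs ] f x * f y) + (∑[ x ∈ xs ] ∑[ y ∈ xs ] f x * f y)
    ≡⟨ sumOver-+ xs _ _ ⟨
  (∑[ x ∈ xs ] (sumOver xs (λ y → f x * f y) + sumOver xs (λ y → f x * f y)))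
    ≡⟨ sumOver-cong xs (λ x → sym (sumOver-+ xs _ _)) ⟩
  (∑[ x ∈ xs ] ∑[ y ∈ xs ] (f x * f y + f x * f y))
    ≤⟨ sumOver-mono xs (λ x → sumOver-mono xs (λ y → 2ab≤a²+b² (f x) (f y))) ⟩
  (∑[ x ∈ xs ] ∑[ y ∈ xs ] (f x * f x + f y * f y))
    ≡⟨ sumOver-cong xs (λ x → trans (sumOver-+ xs _ _) (cong (_+ V) (sumOver-const xs (f x * f x)))) ⟩
  (∑[ x ∈ xs ] (length xs * (f x * f x) + V))
    ≡⟨ trans (sumOver-+ xs _ _) (cong₂ _+_ (sumOver-*ˡ xs (length xs) _) (sumOver-const xs V)) ⟩
  length xs * V + length xs * V                               ≡⟨ cong ((length xs * V) +_) (+-identityʳ _) ⟨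
  2 * (length xs * V)                                         ∎)
  where
  open ≤-Reasoning
  S = sumOver xs f
  V = ∑[ x ∈ xs ] f x * f x
  product : (∑[ x ∈ xs ] ∑[ y ∈ xs ] f x * f y) ≡ S * S
  product = trans (sumOver-cong xs (λ x → sumOver-*ˡ xs (f x) f)) (sumOver-*ʳ xs S f)

sumOver-interval-term : ∀ n i (f : ℕ → ℕ) → i < n → f (suc i) ≤ sumOver (interval 0 n) f
sumOver-interval-term n i f i<n = begin
  f (suc i)                                     ≡⟨ cong (f ∘ suc) (+-identityʳ i) ⟨
  f (suc (i + 0))                               ≤⟨ m≤m+n _ 0 ⟩
  sumOver (interval i 1) f                      ≤⟨ sumOver-interval-⊆ 0 i 1 (n ∸ suc i) f ⟩
  sumOver (interval 0 (i + suc (n ∸ suc i))) f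
    ≡⟨ cong (λ m → sumOver (interval 0 m) f) (trans (+-suc i _) (m+[n∸m]≡n i<n)) ⟩
  sumOver (interval 0 n) f                      ∎
  where open ≤-Reasoning

⟦≟⟧-total : ∀ R v → v < R → 1 ≤ (∑[ s ∈ interval 0 R ] ⟦ suc v ≟ s ⟧)
⟦≟⟧-total R v v<R = ≤-trans (≤-reflexive (sym (⟦⟧-true (suc v ≟ suc v) refl)))
                            (sumOver-interval-term R v (λ s → ⟦ suc v ≟ s ⟧) v<R)

⟦⟧-*-mono : {R : Set} (P? : Dec P) (Q? : Dec Q) (R? : Dec R) → (P → Q → R) → ⟦ P? ⟧ * ⟦ Q? ⟧ ≤ ⟦ P? ⟧ * ⟦ R? ⟧
⟦⟧-*-mono (yes p) Q? R? f = +-monoˡ-≤ 0 (⟦⟧-mono Q? R? (f p))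
⟦⟧-*-mono (no _)  Q? R? f = z≤n

-- Induction step for counting mutually exclusive events: if the first one occurs, the remaining
-- count `m` vanishes.
⟦⟧+-≤1 : (P? : Dec P) {m : ℕ} → m ≤ 1 → (P → m ≡ 0) → ⟦ P? ⟧ + m ≤ 1
⟦⟧+-≤1 (yes p) m≤1 P→m≡0 = ≤-reflexive (cong suc (P→m≡0 p))
⟦⟧+-≤1 (no _)  m≤1 P→m≡0 = m≤1

⟦≟⟧-total≤1 : ∀ c R v → (∑[ s ∈ interval c R ] ⟦ v ≟ s ⟧) ≤ 1
⟦≟⟧-total≤1 c zero    v = z≤n
⟦≟⟧-total≤1 c (suc R) v = begin
  sumOver (interval c (1 + R)) f                              ≡⟨ sumOver-interval-+ c 1 R f ⟩
  (f (suc (c + 0)) + 0) + sumOver (interval (c + 1) R) f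
    ≡⟨ cong₂ (λ m d → m + sumOver (interval d R) f) (trans (+-identityʳ _) (cong (f ∘ suc) (+-identityʳ c))) (+-comm c 1) ⟩
  f (suc c) + sumOver (interval (suc c) R) f                  ≤⟨ ⟦⟧+-≤1 (v ≟ suc c) (⟦≟⟧-total≤1 (suc c) R v) avoid ⟩
  1                                                           ∎
  where
  open ≤-Reasoning
  f = λ s → ⟦ v ≟ s ⟧
  avoid : v ≡ suc c → sumOver (interval (suc c) R) f ≡ 0
  avoid refl = n≤0⇒n≡0 (begin
    sumOver (interval v R) f
      ≤⟨ sumOver-monoᴬ (All.map (λ {x} (v<x , _) → ≤-reflexive (⟦⟧-false (v ≟ x) (<⇒≢ v<x))) (interval-bounds v R)) ⟩
    sumOver (interval v R) (λ _ → 0)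
      ≡⟨ trans (sumOver-const (interval v R) 0) (*-zeroʳ (length (interval v R))) ⟩
    0 ∎)

-- Cauchy-Schwarz applied to the fibre sizes `c s` of `v`. The sum of their squares counts pairs
-- with equal value, and there are at most `R` fibres; as `interval 0 R` starts at 1, the fibres are
-- indexed by `suc (v x)`.
collisions : (xs : List X) (v : X → ℕ) (R : ℕ) → All (λ x → v x < R) xs →
  length xs * length xs ≤ R * (∑[ x ∈ xs ] ∑[ y ∈ xs ] ⟦ v x ≟ v y ⟧)
collisions xs v R v<R = begin
  length xs * length xs                                    ≤⟨ *-mono-≤ len≤ len≤ ⟩
  sumOver (interval 0 R) c * sumOver (interval 0 R) c      ≤⟨ cauchy-schwarz (interval 0 R) c ⟩
  length (interval 0 R) * (∑[ s ∈ interval 0 R ] c s * c s)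
    ≡⟨ cong (_* (∑[ s ∈ interval 0 R ] c s * c s)) (length-interval 0 R) ⟩
  R * (∑[ s ∈ interval 0 R ] c s * c s)                     ≤⟨ *-monoʳ-≤ R squares ⟩
  R * (∑[ x ∈ xs ] ∑[ y ∈ xs ] ⟦ v x ≟ v y ⟧)               ∎
  where
  open ≤-Reasoning
  c : ℕ → ℕ
  c s = ∑[ x ∈ xs ] ⟦ suc (v x) ≟ s ⟧
  len≤ : length xs ≤ sumOver (interval 0 R) c
  len≤ = begin
    length xs                                                ≡⟨ trans (sumOver-const xs 1) (*-identityʳ _) ⟨
    (∑[ x ∈ xs ] 1)
      ≤⟨ sumOver-monoᴬ (All.map (λ {x} → ⟦≟⟧-total R (v x)) v<R) ⟩
    (∑[ x ∈ xs ] ∑[ s ∈ interval 0 R ] ⟦ suc (v x) ≟ s ⟧)     ≡⟨ sumOver-swap xs (interval 0 R) _ ⟩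
    sumOver (interval 0 R) c                                 ∎
  square : ∀ s → c s * c s ≤ (∑[ x ∈ xs ] ∑[ y ∈ xs ] ⟦ suc (v x) ≟ s ⟧ * ⟦ v x ≟ v y ⟧)
  square s = begin
    c s * c s
      ≡⟨ sumOver-*ʳ xs (c s) _ ⟨
    (∑[ x ∈ xs ] ⟦ suc (v x) ≟ s ⟧ * c s)
      ≡⟨ sumOver-cong xs (λ x → sym (sumOver-*ˡ xs ⟦ suc (v x) ≟ s ⟧ _)) ⟩
    (∑[ x ∈ xs ] ∑[ y ∈ xs ] ⟦ suc (v x) ≟ s ⟧ * ⟦ suc (v y) ≟ s ⟧)
      ≤⟨ sumOver-mono xs (λ x → sumOver-mono xs (λ y → ⟦⟧-*-mono (suc (v x) ≟ s) (suc (v y) ≟ s) (v x ≟ v y)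
         (λ p q → suc-injective (trans p (sym q))))) ⟩
    (∑[ x ∈ xs ] ∑[ y ∈ xs ] ⟦ suc (v x) ≟ s ⟧ * ⟦ v x ≟ v y ⟧) ∎
  squares : (∑[ s ∈ interval 0 R ] c s * c s) ≤ (∑[ x ∈ xs ] ∑[ y ∈ xs ] ⟦ v x ≟ v y ⟧)
  squares = begin
    (∑[ s ∈ interval 0 R ] c s * c s)
      ≤⟨ sumOver-mono (interval 0 R) square ⟩
    (∑[ s ∈ interval 0 R ] ∑[ x ∈ xs ] ∑[ y ∈ xs ] ⟦ suc (v x) ≟ s ⟧ * ⟦ v x ≟ v y ⟧)
      ≡⟨ sumOver-swap (interval 0 R) xs _ ⟩
    (∑[ x ∈ xs ] ∑[ s ∈ interval 0 R ] ∑[ y ∈ xs ] ⟦ suc (v x) ≟ s ⟧ * ⟦ v x ≟ v y ⟧)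
      ≡⟨ sumOver-cong xs (λ x → trans (sumOver-cong (interval 0 R) (λ s → sumOver-*ˡ xs ⟦ suc (v x) ≟ s ⟧ _))
           (sumOver-*ʳ (interval 0 R) _ _)) ⟩
    (∑[ x ∈ xs ] (sumOver (interval 0 R) (λ s → ⟦ suc (v x) ≟ s ⟧) * sumOver xs (λ y → ⟦ v x ≟ v y ⟧)))
      ≤⟨ sumOver-mono xs (λ x → ≤-trans (*-monoˡ-≤ _ (⟦≟⟧-total≤1 0 R (suc (v x)))) (≤-reflexive (*-identityˡ _))) ⟩
    (∑[ x ∈ xs ] ∑[ y ∈ xs ] ⟦ v x ≟ v y ⟧) ∎

-- Two halves of length `h` have equal sums for at least a proportion `1 / (hn + 1)` of all pairs,
-- by `collisions`. Reflecting the second half turns equality of the sums into total sum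
-- `h (n + 1)`, and concatenation makes the pair one sequence of length `2h`.
central-sums : ∀ n h → n ^ (h * 2) ≤ suc (h * n) * (∑[ B ∈ sequences n (h * 2) ] ⟦ sum B ≟ h * suc n ⟧)
central-sums n h = begin
  n ^ (h * 2)                             ≡⟨ cong (n ^_) (h*2≡h+h h) ⟩
  n ^ (h + h)                             ≡⟨ ^-distribˡ-+-* n h h ⟩
  n ^ h * n ^ h                           ≡⟨ cong₂ _*_ (length-sequences n h) (length-sequences n h) ⟨
  length Bs * length Bs                   ≤⟨ collisions Bs sum (suc (h * n)) (All.map small (sequences-valid n h)) ⟩
  suc (h * n) * (∑[ B ∈ Bs ] ∑[ C ∈ Bs ] ⟦ sum B ≟ sum C ⟧)
    ≤⟨ *-monoʳ-≤ (suc (h * n)) (sumOver-mono Bs (λ B → sumOver-monoᴬ (All.map (complement B) (sequences-valid n h)))) ⟩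
  suc (h * n) * (∑[ B ∈ Bs ] ∑[ C ∈ Bs ] ⟦ sum B + cosum n C ≟ M ⟧)
    ≡⟨ cong (suc (h * n) *_) (sumOver-cong Bs (λ B → sym (sumOver-cosum n h (λ σ → ⟦ sum B + σ ≟ M ⟧)))) ⟩
  suc (h * n) * (∑[ B ∈ Bs ] ∑[ C ∈ Bs ] ⟦ sum B + sum C ≟ M ⟧)
    ≡⟨ cong (suc (h * n) *_) (sumOver-sequences-+ n h h (λ σ → ⟦ σ ≟ M ⟧)) ⟨
  suc (h * n) * (∑[ B ∈ sequences n (h + h) ] ⟦ sum B ≟ M ⟧)
    ≡⟨ cong (λ k → suc (h * n) * (∑[ B ∈ sequences n k ] ⟦ sum B ≟ M ⟧)) (h*2≡h+h h) ⟨
  suc (h * n) * (∑[ B ∈ sequences n (h * 2) ] ⟦ sum B ≟ M ⟧) ∎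
  where
  open ≤-Reasoning
  Bs = sequences n h
  M = h * suc n
  h*2≡h+h : ∀ h → h * 2 ≡ h + h
  h*2≡h+h = solve-∀
  small : ∀ {B} → length B ≡ h × All (_≤ n) B → sum B < suc (h * n)
  small {B} (refl , B≤n) = s≤s (sum≤ n B≤n)
  complement : ∀ B {C} → length C ≡ h × All (_≤ n) C → ⟦ sum B ≟ sum C ⟧ ≤ ⟦ sum B + cosum n C ≟ M ⟧
  complement B {C} (refl , C≤n) = ⟦⟧-mono (sum B ≟ sum C) (sum B + cosum n C ≟ M)
    (λ eq → trans (cong (_+ cosum n C) eq) (sum+cosum n C≤n))

diceCount-sumOver : ∀ n → diceCount n ≡ (∑[ B ∈ sequences n n ] ⟦ balanced? n B ⟧)
diceCount-sumOver n = length-filter-sumOver (balanced? n) (sequences n n)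

diceCount-even : ∀ h → (h * 2) ^ (h * 2) ≤ suc (h * (h * 2)) * diceCount (h * 2)
diceCount-even h = ≤-trans (central-sums n h) (*-monoʳ-≤ (suc (h * n)) (begin
  (∑[ B ∈ sequences n n ] ⟦ sum B ≟ h * suc n ⟧)
    ≤⟨ sumOver-mono (sequences n n) (λ B → ⟦⟧-mono (sum B ≟ h * suc n) (balanced? n B)
         (λ eq → trans (cong (2 *_) eq) (double h))) ⟩
  (∑[ B ∈ sequences n n ] ⟦ balanced? n B ⟧)     ≡⟨ diceCount-sumOver n ⟨
  diceCount n                                    ∎))
  where
  open ≤-Reasoning
  n = h * 2
  double : ∀ h → 2 * (h * suc (h * 2)) ≡ h * 2 * (h * 2 + 1)
  double = solve-∀

-- Fix the first entry to be the middle value `h + 1`; the other `2h` entries then have to attain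
-- their central sum `h (n + 1)`.
diceCount-odd : ∀ h → suc (h * 2) ^ (h * 2) ≤ suc (h * suc (h * 2)) * diceCount (suc (h * 2))
diceCount-odd h = ≤-trans (central-sums n h) (*-monoʳ-≤ (suc (h * n)) (begin
  (∑[ B ∈ sequences n (h * 2) ] ⟦ sum B ≟ h * suc n ⟧)
    ≤⟨ sumOver-mono (sequences n (h * 2)) (λ B → ⟦⟧-mono (sum B ≟ h * suc n) (balanced? n (suc h ∷ B))
         (λ eq → trans (cong (λ σ → 2 * (suc h + σ)) eq) (double h))) ⟩
  (∑[ B ∈ sequences n (h * 2) ] ⟦ balanced? n (suc h ∷ B) ⟧)
    ≤⟨ sumOver-interval-term n h (λ b → ∑[ B ∈ sequences n (h * 2) ] ⟦ balanced? n (b ∷ B) ⟧) (s≤s (m≤m*n h 2)) ⟩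
  (∑[ b ∈ interval 0 n ] ∑[ B ∈ sequences n (h * 2) ] ⟦ balanced? n (b ∷ B) ⟧)
    ≡⟨ sumOver-sequences-suc n (h * 2) _ ⟨
  (∑[ B ∈ sequences n n ] ⟦ balanced? n B ⟧)     ≡⟨ diceCount-sumOver n ⟨
  diceCount n                                    ∎))
  where
  open ≤-Reasoning
  n = suc (h * 2)
  double : ∀ h → 2 * (suc h + h * suc (suc (h * 2))) ≡ suc (h * 2) * (suc (h * 2) + 1)
  double = solve-∀

-- Exchanges and anticoncentration

module _ (d ρ : ℕ) where

  private
    n = d + (d + ρ)

  -- The range is cut into two blocks of length `d` and a remainder of length `ρ`. Grouping
  -- crosswise puts the two exchanged states next to each other when `u` and `v` are the rows `x`
  -- and `d + x`.
  sumOver-halves : (u v : ℕ → ℕ) → sumOver (interval 0 n) u + sumOver (interval 0 n) v ≡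
    (∑[ y ∈ interval 0 d ] ((u y + v (d + y)) + (u (d + y) + v y))) + (∑[ y ∈ interval (d + d) ρ ] (u y + v y))
  sumOver-halves u v = begin
    sumOver (interval 0 n) u + sumOver (interval 0 n) v
      ≡⟨ cong₂ _+_ (halves u) (halves v) ⟩
    (S u + (S (u ∘ (d +_)) + R u)) + (S v + (S (v ∘ (d +_)) + R v))
      ≡⟨ rearrange (S u) (S (u ∘ (d +_))) (R u) (S v) (S (v ∘ (d +_))) (R v) ⟩
    ((S u + S (v ∘ (d +_))) + (S (u ∘ (d +_)) + S v)) + (R u + R v)
      ≡⟨ cong₂ _+_ (trans (sumOver-+ (interval 0 d) _ _) (cong₂ _+_ (sumOver-+ (interval 0 d) _ _) (sumOver-+ (interval 0 d) _ _)))
                   (sumOver-+ (interval (d + d) ρ) u v) ⟨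
    _ ∎
    where
    open ≡-Reasoning
    S R : (ℕ → ℕ) → ℕ
    S = sumOver (interval 0 d)
    R = sumOver (interval (d + d) ρ)
    halves : ∀ w → sumOver (interval 0 n) w ≡ S w + (S (w ∘ (d +_)) + R w)
    halves w = trans (sumOver-interval-+ 0 d (d + ρ) w) (cong (S w +_)
      (trans (sumOver-interval-+ d d ρ w)
             (cong (_+ R w) (trans (cong (λ c → sumOver (interval c d) w) (sym (+-identityʳ d)))
                                   (sumOver-interval-shift d 0 d w)))))
    rearrange : ∀ a b c a' b' c' → (a + (b + c)) + (a' + (b' + c')) ≡ ((a + b') + (b + a')) + (c + c')
    rearrange = solve-∀

  -- The cells `(x , d + y)` and `(d + x , y)` form disjoint pairs. Each pair gains `c x y` over the
  -- pointwise comparison, which suffices for all other cells.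
  sumOver-exchange : (f g c : ℕ → ℕ → ℕ) → (∀ x y → f x y ≤ g x y) →
    (∀ x y → (f x (d + y) + f (d + x) y) + c x y ≤ g x (d + y) + g (d + x) y) →
    (∑[ x ∈ interval 0 n ] ∑[ y ∈ interval 0 n ] f x y) + (∑[ x ∈ interval 0 d ] ∑[ y ∈ interval 0 d ] c x y)
      ≤ (∑[ x ∈ interval 0 n ] ∑[ y ∈ interval 0 n ] g x y)
  -- Pairing the rows `x` and `d + x` uses `sumOver-halves` with `u = v`, where every pair of rows
  -- appears twice; hence the factor 2.
  sumOver-exchange f g c f≤g exchange = *-cancelˡ-≤ 2 (begin
    2 * (F + C)                                  ≡⟨ double F C ⟩
    (F + F) + (C + C)                            ≡⟨ cong (_+ (C + C)) (sumOver-halves row-f row-f) ⟩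
    (A + B) + (C + C)                            ≡⟨ assoc A B (C + C) ⟩
    (A + (C + C)) + B                            ≡⟨ cong (λ z → (A + z) + B) (sumOver-+ (interval 0 d) row-c row-c) ⟨
    (A + (∑[ x ∈ interval 0 d ] (row-c x + row-c x))) + B
      ≡⟨ cong (_+ B) (sumOver-+ (interval 0 d) _ _) ⟨
    (∑[ x ∈ interval 0 d ] (((row-f x + row-f (d + x)) + (row-f (d + x) + row-f x)) + (row-c x + row-c x))) + B
      ≤⟨ +-mono-≤ (sumOver-mono (interval 0 d) pair-of-rows)
                  (sumOver-mono (interval (d + d) ρ) (λ x → +-mono-≤ (row-mono x) (row-mono x))) ⟩
    (∑[ x ∈ interval 0 d ] ((row-g x + row-g (d + x)) + (row-g (d + x) + row-g x)))
      + (∑[ x ∈ interval (d + d) ρ ] (row-g x + row-g x))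
      ≡⟨ sumOver-halves row-g row-g ⟨
    T + T                                        ≡⟨ cong (T +_) (+-identityʳ T) ⟨
    2 * T                                        ∎)
    where
    open ≤-Reasoning
    row-f row-g row-c : ℕ → ℕ
    row-f x = sumOver (interval 0 n) (f x)
    row-g x = sumOver (interval 0 n) (g x)
    row-c x = sumOver (interval 0 d) (c x)
    F = sumOver (interval 0 n) row-f
    T = sumOver (interval 0 n) row-g
    C = sumOver (interval 0 d) row-c
    A = ∑[ x ∈ interval 0 d ] ((row-f x + row-f (d + x)) + (row-f (d + x) + row-f x))
    B = ∑[ x ∈ interval (d + d) ρ ] (row-f x + row-f x)
    double : ∀ a b → 2 * (a + b) ≡ (a + a) + (b + b)
    double = solve-∀
    assoc : ∀ a b c → (a + b) + c ≡ (a + c) + b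
    assoc = solve-∀
    row-mono : ∀ x → row-f x ≤ row-g x
    row-mono x = sumOver-mono (interval 0 n) (f≤g x)
    rows : ∀ x → (row-f x + row-f (d + x)) + row-c x ≤ row-g x + row-g (d + x)
    rows x = begin
      (row-f x + row-f (d + x)) + row-c x
        ≡⟨ cong (_+ row-c x) (sumOver-halves (f x) (f (d + x))) ⟩
      (U + V) + row-c x
        ≡⟨ assoc U V (row-c x) ⟩
      (U + row-c x) + V
        ≡⟨ cong (_+ V) (sumOver-+ (interval 0 d) _ _) ⟨
      (∑[ y ∈ interval 0 d ] (((f x y + f (d + x) (d + y)) + (f x (d + y) + f (d + x) y)) + c x y)) + V
        ≤⟨ +-mono-≤ (sumOver-mono (interval 0 d) (λ y → ≤-trans (≤-reflexive (+-assoc (f x y + f (d + x) (d + y)) _ (c x y)))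
                      (+-mono-≤ (+-mono-≤ (f≤g x y) (f≤g (d + x) (d + y))) (exchange x y))))
                    (sumOver-mono (interval (d + d) ρ) (λ y → +-mono-≤ (f≤g x y) (f≤g (d + x) y))) ⟩
      (∑[ y ∈ interval 0 d ] ((g x y + g (d + x) (d + y)) + (g x (d + y) + g (d + x) y)))
        + (∑[ y ∈ interval (d + d) ρ ] (g x y + g (d + x) y))
        ≡⟨ sumOver-halves (g x) (g (d + x)) ⟨
      row-g x + row-g (d + x) ∎
      where
      U = ∑[ y ∈ interval 0 d ] ((f x y + f (d + x) (d + y)) + (f x (d + y) + f (d + x) y))
      V = ∑[ y ∈ interval (d + d) ρ ] (f x y + f (d + x) y)
    pair-of-rows : ∀ x → ((row-f x + row-f (d + x)) + (row-f (d + x) + row-f x)) + (row-c x + row-c x)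
                       ≤ (row-g x + row-g (d + x)) + (row-g (d + x) + row-g x)
    pair-of-rows x = begin
      ((row-f x + row-f (d + x)) + (row-f (d + x) + row-f x)) + (row-c x + row-c x)
        ≡⟨ regroup (row-f x) (row-f (d + x)) (row-c x) ⟩
      2 * ((row-f x + row-f (d + x)) + row-c x)
        ≤⟨ *-monoʳ-≤ 2 (rows x) ⟩
      2 * (row-g x + row-g (d + x))
        ≡⟨ regroup′ (row-g x) (row-g (d + x)) ⟩
      (row-g x + row-g (d + x)) + (row-g (d + x) + row-g x) ∎
      where
      regroup : ∀ a b c → ((a + b) + (b + a)) + (c + c) ≡ 2 * ((a + b) + c)
      regroup = solve-∀
      regroup′ : ∀ a b → 2 * (a + b) ≡ (a + b) + (b + a)
      regroup′ = solve-∀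

active : ℕ → (ℕ → ℕ) → ℕ
active d G = ∑[ x ∈ interval 0 d ] ∑[ y ∈ interval 0 d ] ⟦ ¬? (G x + G (d + y) ≟ G (d + x) + G y) ⟧

Decreasing : List ℕ → Set
Decreasing = AllPairs _>_

module Switching (d ρ K : ℕ) (W G : ℕ → ℕ) (W≤1 : ∀ σ → W σ ≤ 1) (t : ℕ) where

  private
    n = d + (d + ρ)
    q = K * K

  -- An entry `x` stands for the target weight `t - x`. In this form a weight already collected is
  -- absorbed by adding it to every entry, and no subtraction occurs.
  hits : List ℕ → ℕ → ℕ
  hits xs g = ∑[ x ∈ xs ] ⟦ x + g ≟ t ⟧

  total : ℕ → ℕ → ℕ
  total k s = ∑[ B ∈ sequences n k ] W (s + sum B)

  -- Here `s` is the sum of the coordinates already fixed and `k` the number of coordinates left, so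
  -- that the constraint `W` on the full sum survives the recursion.
  count : ℕ → ℕ → (ℕ → ℕ) → ℕ
  count k s f = ∑[ B ∈ sequences n k ] W (s + sum B) * f (sumOver B G)

  hits-shift : ∀ c xs g → hits xs (c + g) ≡ hits (map (c +_) xs) g
  hits-shift c xs g = sym (trans (sumOver-map (c +_) xs _)
    (sumOver-cong xs (λ x → cong (λ z → ⟦ z ≟ t ⟧) (move c x g))))
    where
    move : ∀ c x g → (c + x) + g ≡ x + (c + g)
    move = solve-∀

  hits≤1 : ∀ {xs} → Decreasing xs → ∀ g → hits xs g ≤ 1
  hits≤1 []                        g = z≤n
  hits≤1 {x ∷ xs} (x>xs ∷ xs-dec) g = ⟦⟧+-≤1 (x + g ≟ t) (hits≤1 xs-dec g) (λ x+g≡t → n≤0⇒n≡0 (begin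
    hits xs g           ≤⟨ sumOver-monoᴬ (All.map (λ {y} y<x → ≤-reflexive (⟦⟧-false (y + g ≟ t)
                             (λ y+g≡t → <⇒≢ (+-monoˡ-< g y<x) (trans y+g≡t (sym x+g≡t))))) x>xs) ⟩
    (∑[ y ∈ xs ] 0)     ≡⟨ trans (sumOver-const xs 0) (*-zeroʳ (length xs)) ⟩
    0                   ∎))
    where open ≤-Reasoning

  count≤total : ∀ k s {xs} → Decreasing xs → count k s (hits xs) ≤ total k s
  count≤total k s dec = sumOver-mono (sequences n k)
    (λ B → ≤-trans (*-monoʳ-≤ (W (s + sum B)) (hits≤1 dec (sumOver B G))) (≤-reflexive (*-identityʳ _)))

  count-cong : ∀ k s {f g} → (∀ x → f x ≡ g x) → count k s f ≡ count k s g
  count-cong k s f≡g = sumOver-cong (sequences n k) (λ B → cong (W (s + sum B) *_) (f≡g _))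

  count-+ : ∀ k s f g → count k s (λ x → f x + g x) ≡ count k s f + count k s g
  count-+ k s f g = trans (sumOver-cong (sequences n k) (λ B → *-distribˡ-+ (W (s + sum B)) _ _))
                          (sumOver-+ (sequences n k) _ _)

  count-suc : ∀ k s f → count (suc k) s f ≡ (∑[ b ∈ interval 0 n ] count k (s + b) (λ g → f (G b + g)))
  count-suc k s f = trans (sumOver-sequences-suc n k _)
    (sumOver-cong (interval 0 n) (λ b → sumOver-cong (sequences n k)
      (λ B → cong (λ σ → W σ * f (G b + sumOver B G)) (sym (+-assoc s b (sum B))))))

  count-suc² : ∀ k s f → count (suc (suc k)) s f ≡
    (∑[ b ∈ interval 0 n ] ∑[ b′ ∈ interval 0 n ] count k (s + (b + b′)) (λ g → f ((G b + G b′) + g)))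
  count-suc² k s f = trans (count-suc (suc k) s f) (sumOver-cong (interval 0 n) (λ b →
    trans (count-suc k (s + b) (λ g → f (G b + g))) (sumOver-cong (interval 0 n) (λ b′ →
      trans (cong (λ s′ → count k s′ (λ g → f (G b + (G b′ + g)))) (+-assoc s b b′))
            (count-cong k (s + (b + b′)) {λ g → f (G b + (G b′ + g))} {λ g → f ((G b + G b′) + g)}
              (λ g → cong f (sym (+-assoc (G b) (G b′) g))))))))

  total-suc² : ∀ k s → total (suc (suc k)) s ≡
    (∑[ b ∈ interval 0 n ] ∑[ b′ ∈ interval 0 n ] total k (s + (b + b′)))
  total-suc² k s = trans (sumOver-sequences-suc n (suc k) _) (sumOver-cong (interval 0 n) (λ b →
    trans (sumOver-sequences-suc n k _) (sumOver-cong (interval 0 n) (λ b′ →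
      sumOver-cong (sequences n k) (λ B → cong W (reassoc s b b′ (sum B)))))))
    where
    reassoc : ∀ s b b′ σ → s + (b + (b′ + σ)) ≡ (s + (b + b′)) + σ
    reassoc = solve-∀

  module Descent (λ′ a : ℕ) (λ′+a : λ′ + a ≡ q * (n * n)) (a≤ : a ≤ 2 * active d G) where

    -- Denominators are cleared. With `r = length xs`, the count is at most `r / K` of the total
    -- plus `r (K - r) (λ′ / q)^h`. Relative to all `n^(2h)` sequences this error is
    -- `r (K - r) (1 - a / (q n²))^h`; it controls the event that the walk on set sizes has not
    -- stopped.
    Bound : ℕ → Set
    Bound h = ∀ s xs r′ → Decreasing xs → length xs + r′ ≡ K →
      q ^ h * (K * count (h * 2) s (hits xs)) ≤
      q ^ h * (length xs * total (h * 2) s) + (length xs * r′) * (K * λ′ ^ h)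

    shift-dec : ∀ c {xs} → Decreasing xs → Decreasing (map (c +_) xs)
    shift-dec c dec = AllPairsₚ.map⁺ (AllPairs.map (λ {x} {y} → +-monoʳ-< c) dec)

    -- The bound depends on the targets only through their number, so the translation by a collected
    -- weight `c` costs nothing.
    shifted : ∀ h → Bound h → ∀ s xs r′ c → Decreasing xs → length xs + r′ ≡ K →
      q ^ h * (K * count (h * 2) s (λ g → hits xs (c + g))) ≤
      q ^ h * (length xs * total (h * 2) s) + (length xs * r′) * (K * λ′ ^ h)
    shifted h bound s xs r′ c dec len = begin
      q ^ h * (K * count (h * 2) s (λ g → hits xs (c + g)))
        ≡⟨ cong (λ z → q ^ h * (K * z)) (count-cong (h * 2) s (hits-shift c xs)) ⟩
      q ^ h * (K * count (h * 2) s (hits (map (c +_) xs)))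
        ≤⟨ bound s (map (c +_) xs) r′ (shift-dec c dec) (trans (cong (_+ r′) (length-map (c +_) xs)) len) ⟩
      q ^ h * (length (map (c +_) xs) * total (h * 2) s) + (length (map (c +_) xs) * r′) * (K * λ′ ^ h)
        ≡⟨ cong (λ l → q ^ h * (l * total (h * 2) s) + (l * r′) * (K * λ′ ^ h)) (length-map (c +_) xs) ⟩
      q ^ h * (length xs * total (h * 2) s) + (length xs * r′) * (K * λ′ ^ h) ∎
      where open ≤-Reasoning

    -- Handing the largest target over to the other translate turns two sets of size r into
    -- sets of sizes r - 1 and r + 1, on which r ↦ r (K - r) is strictly concave.
    exchanged : ∀ h → Bound h → ∀ s x xs r′ c c′ → Decreasing (x ∷ xs) → length (x ∷ xs) + suc r′ ≡ K → c < c′ →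
      q ^ h * (K * (count (h * 2) s (λ g → hits (x ∷ xs) (c + g)) + count (h * 2) s (λ g → hits (x ∷ xs) (c′ + g))))
        + 2 * (K * λ′ ^ h) ≤
      2 * (q ^ h * (length (x ∷ xs) * total (h * 2) s) + (length (x ∷ xs) * suc r′) * (K * λ′ ^ h))
    exchanged h bound s x xs r′ c c′ dec@(x>xs ∷ xs-dec) len c<c′ = begin
      q ^ h * (K * (count k s (λ g → hits (x ∷ xs) (c + g)) + count k s (λ g → hits (x ∷ xs) (c′ + g)))) + 2 * Λ
        ≡⟨ cong (λ z → q ^ h * (K * z) + 2 * Λ) hand-over ⟩
      q ^ h * (K * (count k s (hits big) + count k s (λ g → hits xs (c′ + g)))) + 2 * Λ
        ≡⟨ distribute (q ^ h) K _ _ Λ ⟩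
      (q ^ h * (K * count k s (hits big)) + q ^ h * (K * count k s (λ g → hits xs (c′ + g)))) + 2 * Λ
        ≤⟨ +-monoˡ-≤ (2 * Λ) (+-mono-≤ (bound s big r′ big-dec big-len)
             (shifted h bound s xs (suc (suc r′)) c′ xs-dec (trans (+-suc (length xs) (suc r′)) len))) ⟩
      ((q ^ h * (length big * N) + (length big * r′) * Λ) + (q ^ h * (length xs * N) + (length xs * suc (suc r′)) * Λ)) + 2 * Λ
        ≡⟨ cong (λ l → ((q ^ h * (l * N) + (l * r′) * Λ) + (q ^ h * (length xs * N) + (length xs * suc (suc r′)) * Λ)) + 2 * Λ)
                (cong (2 +_) (length-map (c +_) xs)) ⟩
      ((q ^ h * (suc (suc r) * N) + (suc (suc r) * r′) * Λ) + (q ^ h * (r * N) + (r * suc (suc r′)) * Λ)) + 2 * Λ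
        ≡⟨ average (q ^ h) r r′ N Λ ⟩
      2 * (q ^ h * (suc r * N) + (suc r * suc r′) * Λ) ∎
      where
      open ≤-Reasoning
      k = h * 2
      r = length xs
      N = total k s
      Λ = K * λ′ ^ h
      big = (c′ + x) ∷ map (c +_) (x ∷ xs)
      big-dec : Decreasing big
      big-dec = (+-monoˡ-< x c<c′ ∷ Allₚ.map⁺ (All.map (λ {y} y<x → +-mono-< c<c′ y<x) x>xs)) ∷ shift-dec c dec
      big-len : length big + r′ ≡ K
      big-len = trans (cong (λ l → suc (suc l) + r′) (length-map (c +_) xs)) (trans (sym (+-suc (suc r) r′)) len)
      move : ∀ c x g → x + (c + g) ≡ (c + x) + g
      move = solve-∀
      hand-over : count k s (λ g → hits (x ∷ xs) (c + g)) + count k s (λ g → hits (x ∷ xs) (c′ + g)) ≡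
                  count k s (hits big) + count k s (λ g → hits xs (c′ + g))
      hand-over = trans (sym (count-+ k s (λ g → hits (x ∷ xs) (c + g)) (λ g → hits (x ∷ xs) (c′ + g))))
        (trans (count-cong k s pointwise) (count-+ k s (hits big) (λ g → hits xs (c′ + g))))
        where
        swap-term : ∀ u v w → u + (v + w) ≡ (v + u) + w
        swap-term = solve-∀
        pointwise : ∀ g → hits (x ∷ xs) (c + g) + hits (x ∷ xs) (c′ + g) ≡ hits big g + hits xs (c′ + g)
        pointwise g = trans (swap-term (hits (x ∷ xs) (c + g)) _ (hits xs (c′ + g)))
          (cong₂ (λ u v → (u + v) + hits xs (c′ + g)) (cong (λ z → ⟦ z ≟ t ⟧) (move c′ x g)) (hits-shift c (x ∷ xs) g))
      distribute : ∀ u K a b Λ → u * (K * (a + b)) + 2 * Λ ≡ (u * (K * a) + u * (K * b)) + 2 * Λ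
      distribute = solve-∀
      average : ∀ u r r′ N Λ → ((u * (suc (suc r) * N) + (suc (suc r) * r′) * Λ) + (u * (r * N) + (r * suc (suc r′)) * Λ)) + 2 * Λ
                  ≡ 2 * (u * (suc r * N) + (suc r * suc r′) * Λ)
      average = solve-∀

    -- Unequal weights of the two states reduce to `exchanged`, after interchanging them if
    -- necessary. For equal weights there is no gain, and the bound is applied to each state
    -- separately.
    exchange-bound : ∀ h → Bound h → ∀ s x xs r′ c c′ → Decreasing (x ∷ xs) → length (x ∷ xs) + suc r′ ≡ K →
      (q ^ h * (K * count (h * 2) s (λ g → hits (x ∷ xs) (c + g)))
        + q ^ h * (K * count (h * 2) s (λ g → hits (x ∷ xs) (c′ + g)))) + ⟦ ¬? (c ≟ c′) ⟧ * (2 * (K * λ′ ^ h)) ≤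
      (q ^ h * (length (x ∷ xs) * total (h * 2) s) + (length (x ∷ xs) * suc r′) * (K * λ′ ^ h))
        + (q ^ h * (length (x ∷ xs) * total (h * 2) s) + (length (x ∷ xs) * suc r′) * (K * λ′ ^ h))
    exchange-bound h bound s x xs r′ c c′ dec len = go (<-cmp c c′)
      where
      open ≤-Reasoning
      Λ = K * λ′ ^ h
      R = q ^ h * (length (x ∷ xs) * total (h * 2) s) + (length (x ∷ xs) * suc r′) * Λ
      T F : ℕ → ℕ
      T c = count (h * 2) s (λ g → hits (x ∷ xs) (c + g))
      F c = q ^ h * (K * T c)
      distribute : ∀ u K a b Λ → (u * (K * a) + u * (K * b)) + Λ ≡ u * (K * (a + b)) + Λ
      distribute = solve-∀
      unequal : ∀ c c′ → c < c′ → (F c + F c′) + 2 * Λ ≤ R + R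
      unequal c c′ c<c′ = begin
        (F c + F c′) + 2 * Λ                       ≡⟨ distribute (q ^ h) K (T c) (T c′) (2 * Λ) ⟩
        q ^ h * (K * (T c + T c′)) + 2 * Λ         ≤⟨ exchanged h bound s x xs r′ c c′ dec len c<c′ ⟩
        2 * R                                      ≡⟨ cong (R +_) (+-identityʳ R) ⟩
        R + R                                      ∎
      loss≤ : ⟦ ¬? (c ≟ c′) ⟧ * (2 * Λ) ≤ 2 * Λ
      loss≤ = ≤-trans (*-monoˡ-≤ (2 * Λ) (⟦⟧≤1 (¬? (c ≟ c′)))) (≤-reflexive (*-identityˡ _))
      go : Tri (c < c′) (c ≡ c′) (c > c′) → (F c + F c′) + ⟦ ¬? (c ≟ c′) ⟧ * (2 * Λ) ≤ R + R
      go (tri< c<c′ _ _) = ≤-trans (+-monoʳ-≤ (F c + F c′) loss≤) (unequal c c′ c<c′)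
      go (tri> _ _ c′<c) = ≤-trans (+-monoʳ-≤ (F c + F c′) loss≤)
        (subst (λ z → z + 2 * Λ ≤ R + R) (+-comm (F c′) (F c)) (unequal c′ c c′<c))
      go (tri≈ _ c≡c′ _) = begin
        (F c + F c′) + ⟦ ¬? (c ≟ c′) ⟧ * (2 * Λ)
          ≡⟨ cong (λ l → (F c + F c′) + l * (2 * Λ)) (⟦⟧-false (¬? (c ≟ c′)) (λ c≢c′ → c≢c′ c≡c′)) ⟩
        (F c + F c′) + 0                           ≡⟨ +-identityʳ _ ⟩
        F c + F c′                                 ≤⟨ +-mono-≤ (shifted h bound s (x ∷ xs) (suc r′) c dec len)
                                                             (shifted h bound s (x ∷ xs) (suc r′) c′ dec len) ⟩
        R + R                                      ∎

    count-[] : ∀ k s → count k s (hits []) ≡ 0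
    count-[] k s = trans (sumOver-cong (sequences n k) (λ B → *-zeroʳ (W (s + sum B))))
      (trans (sumOver-const (sequences n k) 0) (*-zeroʳ (length (sequences n k))))

    -- Induction on the number of coordinate pairs. The main term `r / K` is preserved by the walk,
    -- and the error contracts by the factor `λ′ / (q n²)` relative to the number of states.
    descent : ∀ h → Bound h
    descent h s [] r′ dec len rewrite count-[] (h * 2) s | *-zeroʳ K | *-zeroʳ (q ^ h) = z≤n
    -- The walk is absorbed at `K` targets: the main term is then the whole total.
    descent h s xs@(_ ∷ _) zero dec len = ≤-trans
      (*-monoʳ-≤ (q ^ h) (*-mono-≤ (≤-reflexive (trans (sym len) (+-identityʳ _))) (count≤total (h * 2) s dec)))
      (m≤m+n _ _)
    -- No coordinates are left and the walk is still strictly between 0 and `K`. Then `r r′ ≥ 1`, so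
    -- the error term alone covers a count of at most 1.
    descent zero s xs@(_ ∷ ys) r′@(suc p) dec len = begin
      1 * (K * count 0 s (hits xs))           ≡⟨ *-identityˡ _ ⟩
      K * count 0 s (hits xs)
        ≤⟨ *-monoʳ-≤ K (≤-trans (count≤total 0 s dec) (≤-trans (≤-reflexive (+-identityʳ _)) (W≤1 _))) ⟩
      K * 1                                   ≤⟨ m≤n*m (K * 1) (length xs * r′) ⟩
      (length xs * r′) * (K * 1)              ≤⟨ m≤n+m _ (1 * (length xs * total 0 s)) ⟩
      1 * (length xs * total 0 s) + (length xs * r′) * (K * 1) ∎
      where
      open ≤-Reasoning
    -- The gain from all active pairs is added to both sides in place of being subtracted on the
    -- right.
    descent (suc h) s xs@(x ∷ ys) r′@(suc p) dec len = +-cancelʳ-≤ (q * (active d G * (2 * Λ))) _ _ (begin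
      q ^ suc h * (K * count (2 + k) s (hits xs)) + q * (active d G * (2 * Λ))
        ≡⟨ factor q (q ^ h) (K * count (2 + k) s (hits xs)) (active d G * (2 * Λ)) ⟩
      q * (q ^ h * (K * count (2 + k) s (hits xs)) + active d G * (2 * Λ))
        ≡⟨ cong (q *_) (cong₂ _+_ lhs gain) ⟩
      q * ((∑[ b ∈ interval 0 n ] ∑[ b′ ∈ interval 0 n ] f b b′) + (∑[ y ∈ interval 0 d ] ∑[ z ∈ interval 0 d ] c y z))
        ≤⟨ *-monoʳ-≤ q (sumOver-exchange d ρ f g c
             (λ b b′ → shifted h (descent h) (s + (b + b′)) xs r′ (G b + G b′) dec len) exchange) ⟩
      q * (∑[ b ∈ interval 0 n ] ∑[ b′ ∈ interval 0 n ] g b b′)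
        ≡⟨ cong (q *_) rhs ⟩
      q * (q ^ h * (r * N) + n * (n * (φ * Λ)))
        ≡⟨ expand q (q ^ h) r N n φ Λ ⟩
      q ^ suc h * (r * N) + (q * (n * n)) * (φ * Λ)
        ≡⟨ cong (λ z → q ^ suc h * (r * N) + z * (φ * Λ)) λ′+a ⟨
      q ^ suc h * (r * N) + (λ′ + a) * (φ * Λ)
        ≡⟨ split (q ^ suc h * (r * N)) λ′ a φ K (λ′ ^ h) ⟩
      (q ^ suc h * (r * N) + φ * (K * λ′ ^ suc h)) + (φ * a) * Λ
        -- Since `r r′ ≤ K² = q`, the fixed gain `2 Λ` at each active pair pays for the proportional
        -- decrease `a / (q n²)` of the error `r r′ Λ`.
        ≤⟨ +-monoʳ-≤ _ (*-monoˡ-≤ Λ (*-mono-≤ φ≤q a≤)) ⟩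
      (q ^ suc h * (r * N) + φ * (K * λ′ ^ suc h)) + (q * (2 * active d G)) * Λ
        ≡⟨ cong ((q ^ suc h * (r * N) + φ * (K * λ′ ^ suc h)) +_) (recombine q (active d G) Λ) ⟩
      (q ^ suc h * (r * N) + φ * (K * λ′ ^ suc h)) + q * (active d G * (2 * Λ)) ∎)
      where
      open ≤-Reasoning
      k = h * 2
      r = length xs
      φ = r * r′
      N = total (2 + k) s
      Λ = K * λ′ ^ h
      f g c : ℕ → ℕ → ℕ
      f b b′ = q ^ h * (K * count k (s + (b + b′)) (λ z → hits xs ((G b + G b′) + z)))
      g b b′ = q ^ h * (r * total k (s + (b + b′))) + φ * Λ
      c y z = ⟦ ¬? (G y + G (d + z) ≟ G (d + y) + G z) ⟧ * (2 * Λ)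
      φ≤q : φ ≤ q
      φ≤q = *-mono-≤ (≤-trans (m≤m+n r r′) (≤-reflexive len)) (≤-trans (m≤n+m r′ r) (≤-reflexive len))
      factor : ∀ q u a b → (q * u) * a + q * b ≡ q * (u * a + b)
      factor = solve-∀
      expand : ∀ q u r N n φ Λ → q * (u * (r * N) + n * (n * (φ * Λ))) ≡ (q * u) * (r * N) + (q * (n * n)) * (φ * Λ)
      expand = solve-∀
      split : ∀ u l a φ K m → u + (l + a) * (φ * (K * m)) ≡ (u + φ * (K * (l * m))) + (φ * a) * (K * m)
      split = solve-∀
      recombine : ∀ q A Λ → (q * (2 * A)) * Λ ≡ q * (A * (2 * Λ))
      recombine = solve-∀
      ∑∑-*ˡ : ∀ m u (w : ℕ → ℕ → ℕ) → (∑[ b ∈ interval 0 m ] ∑[ b′ ∈ interval 0 m ] u * w b b′)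
                                      ≡ u * (∑[ b ∈ interval 0 m ] ∑[ b′ ∈ interval 0 m ] w b b′)
      ∑∑-*ˡ m u w = trans (sumOver-cong (interval 0 m) (λ b → sumOver-*ˡ (interval 0 m) u (w b)))
                          (sumOver-*ˡ (interval 0 m) u _)
      lhs : q ^ h * (K * count (2 + k) s (hits xs)) ≡ (∑[ b ∈ interval 0 n ] ∑[ b′ ∈ interval 0 n ] f b b′)
      lhs = sym (trans (∑∑-*ˡ n (q ^ h) _) (cong (q ^ h *_)
        (trans (∑∑-*ˡ n K _) (cong (K *_) (sym (count-suc² k s (hits xs)))))))
      gain : active d G * (2 * Λ) ≡ (∑[ y ∈ interval 0 d ] ∑[ z ∈ interval 0 d ] c y z)
      gain = sym (trans (sumOver-cong (interval 0 d) (λ y → sumOver-*ʳ (interval 0 d) (2 * Λ) _))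
                        (sumOver-*ʳ (interval 0 d) (2 * Λ) _))
      constant : ∀ u → (∑[ b ∈ interval 0 n ] u) ≡ n * u
      constant u = trans (sumOver-const (interval 0 n) u) (cong (_* u) (length-interval 0 n))
      main : ℕ → ℕ → ℕ
      main b b′ = q ^ h * (r * total k (s + (b + b′)))
      rhs : (∑[ b ∈ interval 0 n ] ∑[ b′ ∈ interval 0 n ] g b b′) ≡ q ^ h * (r * N) + n * (n * (φ * Λ))
      rhs = trans (sumOver-cong (interval 0 n) (λ b →
        trans (sumOver-+ (interval 0 n) (main b) (λ _ → φ * Λ))
              (cong (sumOver (interval 0 n) (main b) +_) (constant (φ * Λ)))))
        (trans (sumOver-+ (interval 0 n) _ _) (cong₂ _+_
          (trans (∑∑-*ˡ n (q ^ h) _) (cong (q ^ h *_) (trans (∑∑-*ˡ n r _) (cong (r *_) (sym (total-suc² k s))))))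
          (constant (n * (φ * Λ)))))
      -- Both states have the same sum, so they lead to the same `total` and differ only in the
      -- collected `G`-weight.
      exchange : ∀ y z → (f y (d + z) + f (d + y) z) + c y z ≤ g y (d + z) + g (d + y) z
      exchange y z = subst
        (λ σ → (f y (d + z) + q ^ h * (K * count k (s + σ) (λ g → hits xs ((G (d + y) + G z) + g)))) + c y z
             ≤ g y (d + z) + (q ^ h * (r * total k (s + σ)) + φ * Λ))
        (same-sum d y z)
        (exchange-bound h (descent h) (s + (y + (d + z))) x ys p (G y + G (d + z)) (G (d + y) + G z) dec len)
        where
        same-sum : ∀ d y z → y + (d + z) ≡ (d + y) + z
        same-sum = solve-∀

-- Exponential against polynomial growth

^-distribʳ-* : ∀ h a b → (a * b) ^ h ≡ a ^ h * b ^ h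
^-distribʳ-* zero    a b = refl
^-distribʳ-* (suc h) a b = trans (cong ((a * b) *_) (^-distribʳ-* h a b)) (rearrange a b (a ^ h) (b ^ h))
  where
  rearrange : ∀ a b u v → (a * b) * (u * v) ≡ (a * u) * (b * v)
  rearrange = solve-∀

-- Bernoulli's inequality for `(1 + 1 / p)^j`, with denominators cleared; in the induction step the
-- excess is `j * p ^ j`.
bernoulli : ∀ p j → (p + j) * p ^ j ≤ p * suc p ^ j
bernoulli p zero    = ≤-reflexive (cong (_* 1) (+-identityʳ p))
bernoulli p (suc j) = begin
  (p + suc j) * (p * p ^ j)                  ≤⟨ m≤m+n _ (j * p ^ j) ⟩
  (p + suc j) * (p * p ^ j) + j * p ^ j      ≡⟨ regroup p j (p ^ j) ⟩
  suc p * ((p + j) * p ^ j)                  ≤⟨ *-monoʳ-≤ (suc p) (bernoulli p j) ⟩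
  suc p * (p * suc p ^ j)                    ≡⟨ regroup′ p (suc p ^ j) ⟩
  p * (suc p * suc p ^ j)                    ∎
  where
  open ≤-Reasoning
  regroup : ∀ p j u → (p + suc j) * (p * u) + j * u ≡ suc p * ((p + j) * u)
  regroup = solve-∀
  regroup′ : ∀ p u → suc p * (p * u) ≡ p * (suc p * u)
  regroup′ = solve-∀

-- Split off four blocks of `e` factors from the `h`-th power. By `bernoulli` each block yields a
-- factor `e / p`, and the remaining factors only help.
quartic-vs-exponential : ∀ p e h → 4 * e ≤ h → (e * e) * (e * e) * p ^ h ≤ (p * p) * (p * p) * suc p ^ h
quartic-vs-exponential p e h 4e≤h = begin
  (e * e) * (e * e) * p ^ h                                          ≡⟨ cong ((e * e) * (e * e) *_) (quarters p) ⟩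
  (e * e) * (e * e) * (((u * u) * (u * u)) * p ^ r)                  ≡⟨ regroup e u (p ^ r) ⟩
  (((e * u) * (e * u)) * ((e * u) * (e * u))) * p ^ r
    ≤⟨ *-mono-≤ (*-mono-≤ (*-mono-≤ step step) (*-mono-≤ step step)) (^-monoˡ-≤ r (n≤1+n p)) ⟩
  (((p * v) * (p * v)) * ((p * v) * (p * v))) * suc p ^ r            ≡⟨ regroup p v (suc p ^ r) ⟨
  (p * p) * (p * p) * (((v * v) * (v * v)) * suc p ^ r)
    ≡⟨ cong ((p * p) * (p * p) *_) (quarters (suc p)) ⟨
  (p * p) * (p * p) * suc p ^ h                                      ∎
  where
  open ≤-Reasoning
  r = h ∸ 4 * e
  u = p ^ e
  v = suc p ^ e
  step : e * u ≤ p * v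
  step = ≤-trans (*-monoˡ-≤ u (m≤n+m e p)) (bernoulli p e)
  four : ∀ e → 4 * e ≡ (e + e) + (e + e)
  four = solve-∀
  quarters : ∀ b → b ^ h ≡ ((b ^ e * b ^ e) * (b ^ e * b ^ e)) * b ^ r
  quarters b = begin-equality
    b ^ h                          ≡⟨ cong (b ^_) (m+[n∸m]≡n 4e≤h) ⟨
    b ^ (4 * e + r)                ≡⟨ ^-distribˡ-+-* b (4 * e) r ⟩
    b ^ (4 * e) * b ^ r            ≡⟨ cong (λ m → b ^ m * b ^ r) (four e) ⟩
    b ^ ((e + e) + (e + e)) * b ^ r ≡⟨ cong (_* b ^ r) (trans (^-distribˡ-+-* b (e + e) (e + e))
                                        (cong₂ _*_ (^-distribˡ-+-* b e e) (^-distribˡ-+-* b e e))) ⟩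
    ((b ^ e * b ^ e) * (b ^ e * b ^ e)) * b ^ r ∎
  regroup : ∀ e u w → (e * e) * (e * e) * (((u * u) * (u * u)) * w) ≡ (((e * u) * (e * u)) * ((e * u) * (e * u))) * w
  regroup = solve-∀

halving : ∀ n → ∃[ h ] (n ≡ h * 2 ⊎ n ≡ suc (h * 2))
halving zero    = 0 , inj₁ refl
halving (suc n) with halving n
... | h , inj₁ n≡2h  = h , inj₂ (cong suc n≡2h)
... | h , inj₂ n≡2h+1 = suc h , inj₁ (cong suc n≡2h+1)

diceCount-lower : ∀ n h → n ≡ h * 2 ⊎ n ≡ suc (h * 2) → n ^ (h * 2) ≤ suc (h * n) * diceCount n
diceCount-lower _ h (inj₁ refl) = diceCount-even h
diceCount-lower _ h (inj₂ refl) = diceCount-odd h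

-- Anticoncentration over random dice

module Anticoncentration (K′ : ℕ) where

  K q p threshold : ℕ
  K = suc K′
  q = K * K
  -- Chosen so that `p + 1 = 256 q`. As `n ≤ 16 e`, the contraction `1 - e² / (q n²)` is then at
  -- most `p / (p + 1)`.
  p = pred (256 * q)
  -- The polynomial loss is cubic in `e` with constant `8192 K² = (256 + 256) · 16 · K²`. One spare
  -- factor `e` of the quartic absorbs this constant together with `p⁴`.
  threshold = suc (8192 * (K * K) * ((p * p) * (p * p)))

  module _ (e ρ : ℕ) (e-large : threshold ≤ e) (ρ≤8e : ρ ≤ 8 * e) where

    n : ℕ
    n = 4 * e + (4 * e + ρ)

    n≤16e : n ≤ 16 * e
    n≤16e = ≤-trans (+-monoʳ-≤ (4 * e) (+-monoʳ-≤ (4 * e) ρ≤8e)) (≤-reflexive (collect e))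
      where
      collect : ∀ e → 4 * e + (4 * e + 8 * e) ≡ 16 * e
      collect = solve-∀

    8e≤n : 8 * e ≤ n
    8e≤n = ≤-trans (≤-reflexive (collect e)) (+-monoʳ-≤ (4 * e) (m≤m+n (4 * e) ρ))
      where
      collect : ∀ e → 8 * e ≡ 4 * e + 4 * e
      collect = solve-∀

    1≤n : 1 ≤ n
    1≤n = ≤-trans (≤-trans (s≤s z≤n) e-large) (≤-trans (m≤n*m e 8) 8e≤n)

    M λ′ : ℕ
    M = q * (n * n)
    λ′ = M ∸ e * e

    n²≤256e² : n * n ≤ 256 * (e * e)
    n²≤256e² = ≤-trans (*-mono-≤ n≤16e n≤16e) (≤-reflexive (square e))
      where
      square : ∀ e → (16 * e) * (16 * e) ≡ 256 * (e * e)
      square = solve-∀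

    e≤n : e ≤ n
    e≤n = ≤-trans (m≤n*m e 8) 8e≤n

    λ′+e² : λ′ + e * e ≡ M
    λ′+e² = m∸n+n≡m (≤-trans (*-mono-≤ e≤n e≤n) (m≤n*m (n * n) q))

    λ′-ratio : λ′ * suc p ≤ M * p
    λ′-ratio = begin
      λ′ * suc p                ≡⟨ *-suc λ′ p ⟩
      λ′ + λ′ * p               ≤⟨ +-monoˡ-≤ (λ′ * p) λ′≤ ⟩
      (e * e) * p + λ′ * p      ≡⟨ +-comm ((e * e) * p) _ ⟩
      λ′ * p + (e * e) * p      ≡⟨ *-distribʳ-+ p λ′ (e * e) ⟨
      (λ′ + e * e) * p          ≡⟨ cong (_* p) λ′+e² ⟩
      M * p                     ∎
      where
      open ≤-Reasoning
      regroup : ∀ q s → q * (256 * s) ≡ s * (256 * q)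
      regroup = solve-∀
      λ′≤ : λ′ ≤ (e * e) * p
      λ′≤ = +-cancelʳ-≤ (e * e) _ _ (begin
        λ′ + e * e              ≡⟨ λ′+e² ⟩
        q * (n * n)             ≤⟨ *-monoʳ-≤ q n²≤256e² ⟩
        q * (256 * (e * e))     ≡⟨ regroup q (e * e) ⟩
        (e * e) * suc p         ≡⟨ *-suc (e * e) p ⟩
        e * e + (e * e) * p     ≡⟨ +-comm (e * e) _ ⟩
        (e * e) * p + e * e     ∎)

    module _ (h : ℕ) (n-parity : n ≡ h * 2 ⊎ n ≡ suc (h * 2)) where

      2h≤n : h * 2 ≤ n
      2h≤n = [ (λ eq → ≤-reflexive (sym eq)) , (λ eq → ≤-trans (n≤1+n _) (≤-reflexive (sym eq))) ]′ n-parity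

      n≤2h+1 : n ≤ suc (h * 2)
      n≤2h+1 = [ (λ eq → ≤-trans (≤-reflexive eq) (n≤1+n _)) , ≤-reflexive ]′ n-parity

      4e≤h : 4 * e ≤ h
      4e≤h with 4 * e ≤? h
      ... | yes p = p
      ... | no ¬p = contradiction (begin
        suc (suc (h * 2))   ≤⟨ *-monoˡ-≤ 2 (≰⇒> ¬p) ⟩
        (4 * e) * 2         ≡⟨ collect e ⟩
        8 * e               ≤⟨ 8e≤n ⟩
        n                   ≤⟨ n≤2h+1 ⟩
        suc (h * 2)         ∎) 1+n≰n
        where
        open ≤-Reasoning
        collect : ∀ e → (4 * e) * 2 ≡ 8 * e
        collect = solve-∀

      -- The total loss to be beaten: `1 + hn` from the lower bound on the number of dice, `n` from
      -- a possible unpaired coordinate, and `K′ K` from the error term for one target.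
      polynomial : ℕ
      polynomial = suc (h * n) * (n * (K′ * K))

      p⁴ : ℕ
      p⁴ = (p * p) * (p * p)

      polynomial-bound : polynomial * p⁴ ≤ (e * e) * (e * e)
      polynomial-bound = begin
        suc (h * n) * (n * (K′ * K)) * p⁴
          ≤⟨ *-monoˡ-≤ p⁴ (*-mono-≤ (+-mono-≤ (*-mono-≤ 1≤n 1≤n) (*-monoˡ-≤ n (≤-trans (m≤m*n h 2) 2h≤n)))
               (*-monoʳ-≤ n (*-monoˡ-≤ K (n≤1+n K′)))) ⟩
        (n * n + n * n) * (n * (K * K)) * p⁴
          ≤⟨ *-monoˡ-≤ p⁴ (*-mono-≤ (+-mono-≤ n²≤256e² n²≤256e²) (*-monoˡ-≤ (K * K) n≤16e)) ⟩
        (256 * (e * e) + 256 * (e * e)) * (16 * e * (K * K)) * p⁴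
          ≡⟨ collect e (K * K) p⁴ ⟩
        (e * e) * (e * (8192 * (K * K) * p⁴))
          ≤⟨ *-monoʳ-≤ (e * e) (*-monoʳ-≤ e (≤-trans (n≤1+n _) e-large)) ⟩
        (e * e) * (e * e) ∎
        where
        open ≤-Reasoning
        collect : ∀ e k w → (256 * (e * e) + 256 * (e * e)) * (16 * e * k) * w ≡ (e * e) * (e * (8192 * k * w))
        collect = solve-∀

      -- The `h`-th power of `λ′-ratio` reduces the claim to
      -- `polynomial * p⁴ * p ^ h ≤ p⁴ * suc p ^ h`, up to the factor `M ^ h`. The left side is at
      -- most `e⁴ p^h`, and `quartic-vs-exponential` applies.
      error-bound : polynomial * λ′ ^ h ≤ M ^ h
      error-bound = *-cancelʳ-≤ _ _ (p⁴ * suc p ^ h) {{m*n≢0 p⁴ (suc p ^ h) {{p⁴≢0}} {{m^n≢0 (suc p) h}}}} (begin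
        (polynomial * λ′ ^ h) * (p⁴ * suc p ^ h)       ≡⟨ regroup polynomial (λ′ ^ h) p⁴ (suc p ^ h) ⟩
        (polynomial * p⁴) * (λ′ ^ h * suc p ^ h)       ≡⟨ cong ((polynomial * p⁴) *_) (^-distribʳ-* h λ′ (suc p)) ⟨
        (polynomial * p⁴) * (λ′ * suc p) ^ h           ≤⟨ *-mono-≤ polynomial-bound (^-monoˡ-≤ h λ′-ratio) ⟩
        (e * e) * (e * e) * (M * p) ^ h                ≡⟨ cong ((e * e) * (e * e) *_) (^-distribʳ-* h M p) ⟩
        (e * e) * (e * e) * (M ^ h * p ^ h)            ≡⟨ regroup′ ((e * e) * (e * e)) (M ^ h) (p ^ h) ⟩
        M ^ h * ((e * e) * (e * e) * p ^ h)            ≤⟨ *-monoʳ-≤ (M ^ h) (quartic-vs-exponential p e h 4e≤h) ⟩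
        M ^ h * (p⁴ * suc p ^ h)                       ∎)
        where
        open ≤-Reasoning
        instance
          p≢0 : NonZero p
          p≢0 = >-nonZero (pred-mono-≤ (*-mono-≤ {2} {256} {1} {q} (s≤s (s≤s z≤n)) (s≤s z≤n)))
        p⁴≢0 : NonZero p⁴
        p⁴≢0 = m*n≢0 (p * p) (p * p) {{m*n≢0 p p}} {{m*n≢0 p p}}
        regroup : ∀ a b c d → (a * b) * (c * d) ≡ (a * c) * (b * d)
        regroup = solve-∀
        regroup′ : ∀ a b c → a * (b * c) ≡ b * (a * c)
        regroup′ = solve-∀

      error≤dice : n * (K′ * (K * λ′ ^ h)) ≤ q ^ h * diceCount n
      error≤dice = *-cancelˡ-≤ (suc (h * n)) (begin
        suc (h * n) * (n * (K′ * (K * λ′ ^ h)))    ≡⟨ regroup (suc (h * n)) n K′ K (λ′ ^ h) ⟩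
        polynomial * λ′ ^ h                        ≤⟨ error-bound ⟩
        (q * (n * n)) ^ h                          ≡⟨ ^-distribʳ-* h q (n * n) ⟩
        q ^ h * (n * n) ^ h                        ≡⟨ cong (q ^ h *_) n²^h ⟩
        q ^ h * n ^ (h * 2)                        ≤⟨ *-monoʳ-≤ (q ^ h) (diceCount-lower n h n-parity) ⟩
        q ^ h * (suc (h * n) * diceCount n)        ≡⟨ regroup′ (q ^ h) (suc (h * n)) (diceCount n) ⟩
        suc (h * n) * (q ^ h * diceCount n)        ∎)
        where
        open ≤-Reasoning
        n²^h : (n * n) ^ h ≡ n ^ (h * 2)
        n²^h = trans (cong (λ m → (n * m) ^ h) (sym (*-identityʳ n))) (trans (^-*-assoc n 2 h) (cong (n ^_) (*-comm 2 h)))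
        regroup : ∀ a n k K l → a * (n * (k * (K * l))) ≡ (a * (n * (k * K))) * l
        regroup = solve-∀
        regroup′ : ∀ a b c → a * (b * c) ≡ b * (a * c)
        regroup′ = solve-∀

    module _ (G : ℕ → ℕ) (t : ℕ) where

      W : ℕ → ℕ
      W σ = ⟦ 2 * σ ≟ n * (n + 1) ⟧

      open Switching (4 * e) ρ K W G (λ σ → ⟦⟧≤1 (2 * σ ≟ n * (n + 1))) t

      module _ (e²≤2active : e * e ≤ 2 * active (4 * e) G) where

        open Descent λ′ (e * e) λ′+e² e²≤2active

        -- The case of one target, `r = 1` and `K - r = K′`; the list entry 0 stands for the target
        -- `t` itself.
        singleton : ∀ h s c → q ^ h * (K * count (h * 2) s (λ g → hits (0 ∷ []) (c + g))) ≤
                              q ^ h * total (h * 2) s + K′ * (K * λ′ ^ h)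
        singleton h s c = ≤-trans (shifted h (descent h) s (0 ∷ []) K′ c ([] ∷ []) refl)
          (≤-reflexive (cong₂ (λ u v → q ^ h * u + v * (K * λ′ ^ h)) (*-identityˡ (total (h * 2) s)) (*-identityˡ K′)))

        -- In odd length the first coordinate is summed out, and the error is paid once for each of
        -- its `n` values. The even case is weakened to the same form.
        all-coordinates : ∀ h k → k ≡ h * 2 ⊎ k ≡ suc (h * 2) →
          q ^ h * (K * count k 0 (hits (0 ∷ []))) ≤ q ^ h * total k 0 + n * (K′ * (K * λ′ ^ h))
        all-coordinates h _ (inj₁ refl) = ≤-trans (singleton h 0 0) (+-monoʳ-≤ (q ^ h * total (h * 2) 0)
          (m≤n*m (K′ * (K * λ′ ^ h)) n {{>-nonZero 1≤n}}))
        all-coordinates h _ (inj₂ refl) = begin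
          q ^ h * (K * count (suc (h * 2)) 0 (hits (0 ∷ [])))
            ≡⟨ cong (λ z → q ^ h * (K * z)) (count-suc (h * 2) 0 (hits (0 ∷ []))) ⟩
          q ^ h * (K * (∑[ b ∈ interval 0 n ] count (h * 2) b (λ g → hits (0 ∷ []) (G b + g))))
            ≡⟨ trans (sumOver-*ˡ (interval 0 n) (q ^ h) _) (cong (q ^ h *_) (sumOver-*ˡ (interval 0 n) K _)) ⟨
          (∑[ b ∈ interval 0 n ] q ^ h * (K * count (h * 2) b (λ g → hits (0 ∷ []) (G b + g))))
            ≤⟨ sumOver-mono (interval 0 n) (λ b → singleton h b (G b)) ⟩
          (∑[ b ∈ interval 0 n ] (q ^ h * total (h * 2) b + K′ * (K * λ′ ^ h)))
            ≡⟨ sumOver-+ (interval 0 n) (λ b → q ^ h * total (h * 2) b) (λ _ → K′ * (K * λ′ ^ h)) ⟩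
          (∑[ b ∈ interval 0 n ] q ^ h * total (h * 2) b) + (∑[ b ∈ interval 0 n ] K′ * (K * λ′ ^ h))
            ≡⟨ cong₂ _+_ (trans (sumOver-*ˡ (interval 0 n) (q ^ h) _) (cong (q ^ h *_) (sym (sumOver-sequences-suc n (h * 2) _))))
                         (trans (sumOver-const (interval 0 n) _) (cong (_* (K′ * (K * λ′ ^ h))) (length-interval 0 n))) ⟩
          q ^ h * total (suc (h * 2)) 0 + n * (K′ * (K * λ′ ^ h)) ∎
          where open ≤-Reasoning

        -- The main term is one `diceCount n`; by `error≤dice` the error is at most another, whence
        -- the constant 2.
        anticoncentration : K * (∑[ B ∈ dice n ] ⟦ sumOver B G ≟ t ⟧) ≤ 2 * diceCount n
        anticoncentration with halving n
        ... | h , n-parity = *-cancelˡ-≤ (q ^ h) {{m^n≢0 q h}} (begin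
          q ^ h * (K * (∑[ B ∈ dice n ] ⟦ sumOver B G ≟ t ⟧))
            ≡⟨ cong (λ z → q ^ h * (K * z)) (trans (sumOver-filter (balanced? n) (sequences n n) _)
                 (sumOver-cong (sequences n n) (λ B → cong (⟦ balanced? n B ⟧ *_) (sym (+-identityʳ _))))) ⟩
          q ^ h * (K * count n 0 (hits (0 ∷ [])))
            ≤⟨ all-coordinates h n n-parity ⟩
          q ^ h * total n 0 + n * (K′ * (K * λ′ ^ h))
            ≤⟨ +-mono-≤ (≤-reflexive (cong (q ^ h *_) (sym (diceCount-sumOver n)))) (error≤dice h n-parity) ⟩
          q ^ h * diceCount n + q ^ h * diceCount n
            ≡⟨ double (q ^ h) (diceCount n) ⟩
          q ^ h * (2 * diceCount n) ∎)
          where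
          open ≤-Reasoning
          double : ∀ a b → a * b + a * b ≡ a * (2 * b)
          double = solve-∀

-- Ties

-- Twice the indicator of `a < b` in which equality counts one half; doubling keeps it a natural
-- number.
χ : ℕ → ℕ → ℕ
χ b a = ⟦ a <? b ⟧ + ⟦ a ≤? b ⟧

χ-< : ∀ {a b} → a < b → χ b a ≡ 2
χ-< {a} {b} a<b = cong₂ _+_ (⟦⟧-true (a <? b) a<b) (⟦⟧-true (a ≤? b) (<⇒≤ a<b))

χ-> : ∀ {a b} → b < a → χ b a ≡ 0
χ-> {a} {b} b<a = cong₂ _+_ (⟦⟧-false (a <? b) (<-asym b<a)) (⟦⟧-false (a ≤? b) (<⇒≱ b<a))

χ≤2 : ∀ b a → χ b a ≤ 2
χ≤2 b a = +-mono-≤ (⟦⟧≤1 (a <? b)) (⟦⟧≤1 (a ≤? b))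

score : List ℕ → ℕ → ℕ
score A b = ∑[ a ∈ A ] χ b a

wins-sumOver : ∀ A B → wins A B ≡ (∑[ a ∈ A ] ∑[ b ∈ B ] ⟦ b <? a ⟧)
wins-sumOver A B = trans (length-filter-sumOver (λ p → proj₂ p <? proj₁ p) (cartesianProduct A B))
                         (sumOver-cartesianProduct A B (λ p → ⟦ proj₂ p <? proj₁ p ⟧))

<⊎≥-indicator : ∀ a b → ⟦ b <? a ⟧ + ⟦ a ≤? b ⟧ ≡ 1
<⊎≥-indicator a b with <-≤-connex b a
... | inj₁ b<a = cong₂ _+_ (⟦⟧-true (b <? a) b<a) (⟦⟧-false (a ≤? b) (<⇒≱ b<a))
... | inj₂ a≤b = cong₂ _+_ (⟦⟧-false (b <? a) (≤⇒≯ a≤b)) (⟦⟧-true (a ≤? b) a≤b)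

-- In a tie the pairs with `a < b` may be replaced by those with `b < a`. Together with the pairs
-- `a ≤ b` these exhaust all pairs.
tie-score : ∀ A B → wins A B ≡ wins B A → sumOver B (score A) ≡ length B * length A
tie-score A B tie = begin
  sumOver B (score A)
    ≡⟨ sumOver-cong B (λ b → sumOver-+ A _ _) ⟩
  (∑[ b ∈ B ] (sumOver A (λ a → ⟦ a <? b ⟧) + sumOver A (λ a → ⟦ a ≤? b ⟧)))
    ≡⟨ sumOver-+ B _ _ ⟩
  (∑[ b ∈ B ] ∑[ a ∈ A ] ⟦ a <? b ⟧) + (∑[ b ∈ B ] ∑[ a ∈ A ] ⟦ a ≤? b ⟧)
    ≡⟨ cong (_+ (∑[ b ∈ B ] ∑[ a ∈ A ] ⟦ a ≤? b ⟧)) (trans (sym (wins-sumOver B A)) (trans (sym tie)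
         (trans (wins-sumOver A B) (sumOver-swap A B _)))) ⟩
  (∑[ b ∈ B ] ∑[ a ∈ A ] ⟦ b <? a ⟧) + (∑[ b ∈ B ] ∑[ a ∈ A ] ⟦ a ≤? b ⟧)
    ≡⟨ sumOver-+ B _ _ ⟨
  (∑[ b ∈ B ] (sumOver A (λ a → ⟦ b <? a ⟧) + sumOver A (λ a → ⟦ a ≤? b ⟧)))
    ≡⟨ sumOver-cong B (λ b → trans (sym (sumOver-+ A _ _)) (trans (sumOver-cong A (λ a → <⊎≥-indicator a b))
         (trans (sumOver-const A 1) (*-identityʳ (length A))))) ⟩
  (∑[ b ∈ B ] length A)
    ≡⟨ sumOver-const B (length A) ⟩
  length B * length A ∎
  where open ≡-Reasoning

module _ (d : ℕ) where

  -- Sums to 4 · |A| over a die A exactly when the exchange (x , d + y) ↔ (d + x , y) does not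
  -- change the score against A; the 4 ∸ _ avoids negative weights.
  balance : ℕ → ℕ → ℕ → ℕ
  balance x y a = (χ x a + χ (d + y) a) + (4 ∸ (χ (d + x) a + χ y a))

  balance-sum : ∀ A x y → score A x + score A (d + y) ≡ score A (d + x) + score A y →
    sumOver A (balance x y) ≡ length A * 4
  balance-sum A x y eq = +-cancelˡ-≡ (score A (d + x) + score A y) _ _ (begin
    (score A (d + x) + score A y) + sumOver A (balance x y)
      ≡⟨ cong (_+ sumOver A (balance x y)) (sumOver-+ A _ _) ⟨
    (∑[ a ∈ A ] (χ (d + x) a + χ y a)) + sumOver A (balance x y)
      ≡⟨ sumOver-+ A _ _ ⟨
    (∑[ a ∈ A ] ((χ (d + x) a + χ y a) + balance x y a))
      -- By `χ≤2` the subtrahend is at most 4, so `4 ∸ _` is an honest subtraction.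
      ≡⟨ sumOver-cong A (λ a → trans (swap-term (χ (d + x) a + χ y a) (χ x a + χ (d + y) a) (4 ∸ (χ (d + x) a + χ y a)))
           (cong ((χ x a + χ (d + y) a) +_) (m+[n∸m]≡n (+-mono-≤ (χ≤2 (d + x) a) (χ≤2 y a))))) ⟩
    (∑[ a ∈ A ] ((χ x a + χ (d + y) a) + 4))
      ≡⟨ sumOver-+ A _ _ ⟩
    (∑[ a ∈ A ] (χ x a + χ (d + y) a)) + (∑[ a ∈ A ] 4)
      ≡⟨ cong₂ _+_ (trans (sumOver-+ A _ _) eq) (sumOver-const A 4) ⟩
    (score A (d + x) + score A y) + length A * 4 ∎)
    where
    open ≡-Reasoning
    swap-term : ∀ a b c → a + (b + c) ≡ b + (a + c)
    swap-term = solve-∀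

  balance-values : ∀ {x y a v₁ v₂ v₃ v₄} → χ x a ≡ v₁ → χ (d + y) a ≡ v₂ → χ (d + x) a ≡ v₃ → χ y a ≡ v₄ →
    balance x y a ≡ (v₁ + v₂) + (4 ∸ (v₃ + v₄))
  balance-values refl refl refl refl = refl

  -- In the order `v < x < u < y` the weight takes the values 2, 4, 6, 4 at `u`, `d + v`, `d + u`,
  -- `v`, and `2 + 4` differs from `6 + 4`.
  balance-exchange : ∀ {x y u v} → 0 < v → v < x → x < u → u < y → y ≤ d →
    ¬ (balance x y u + balance x y (d + v) ≡ balance x y (d + u) + balance x y v)
  balance-exchange {x} {y} {u} {v} 0<v v<x x<u u<y y≤d eq =
    contradiction (trans (sym (cong₂ _+_ at-u at-d+v)) (trans eq (cong₂ _+_ at-d+u at-v))) λ ()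
    where
    x<y = <-trans x<u u<y
    above : ∀ {z w} → z ≤ d → 0 < w → z < d + w
    above z≤d 0<w = ≤-<-trans z≤d (m<m+n d 0<w)
    0<x = ≤-<-trans z≤n v<x
    0<u = ≤-<-trans z≤n x<u
    0<y = ≤-<-trans z≤n u<y
    v<u = <-trans v<x x<u
    v<y = <-trans v<x x<y
    x≤d = ≤-trans (<⇒≤ x<y) y≤d
    u≤d = ≤-trans (<⇒≤ u<y) y≤d
    at-u : balance x y u ≡ 2
    at-u = balance-values (χ-> x<u) (χ-< (above u≤d 0<y)) (χ-< (above u≤d 0<x)) (χ-< u<y)
    at-v : balance x y v ≡ 4
    at-v = balance-values (χ-< v<x) (χ-< (<-trans v<u (above u≤d 0<y))) (χ-< (<-trans v<u (above u≤d 0<x))) (χ-< v<y)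
    at-d+u : balance x y (d + u) ≡ 6
    at-d+u = balance-values (χ-> (above x≤d 0<u)) (χ-< (+-monoʳ-< d u<y)) (χ-> (+-monoʳ-< d x<u)) (χ-> (above y≤d 0<u))
    at-d+v : balance x y (d + v) ≡ 4
    at-d+v = balance-values (χ-> (above x≤d 0<v)) (χ-< (+-monoʳ-< d v<y)) (χ-< (+-monoʳ-< d v<x)) (χ-> (above y≤d 0<v))

-- Double sums over quarters of `[1, 4e]`

module _ (e : ℕ) where

  private
    d = 4 * e

  quarter : ℕ → List ℕ
  quarter i = interval (i * e) e

  sumOver-quarter : ∀ i j → suc (i + j) ≡ 4 → ∀ f → sumOver (quarter i) f ≤ sumOver (interval 0 d) f
  sumOver-quarter i j eq f = ≤-trans (sumOver-interval-⊆ 0 (i * e) e (j * e) f)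
    (≤-reflexive (cong (λ m → sumOver (interval 0 m) f) (trans (collect i j e) (cong (_* e) eq))))
    where
    collect : ∀ i j e → i * e + (e + j * e) ≡ suc (i + j) * e
    collect = solve-∀

  quarters-const : ∀ i j c → (∑[ x ∈ quarter i ] ∑[ y ∈ quarter j ] c) ≡ (e * e) * c
  quarters-const i j c = begin
    (∑[ x ∈ quarter i ] ∑[ y ∈ quarter j ] c)      ≡⟨ sumOver-cong (quarter i) (λ _ → constant j c) ⟩
    (∑[ x ∈ quarter i ] e * c)                    ≡⟨ constant i (e * c) ⟩
    e * (e * c)                                   ≡⟨ *-assoc e e c ⟨
    (e * e) * c                                   ∎
    where
    open ≡-Reasoning
    constant : ∀ i c → (∑[ x ∈ quarter i ] c) ≡ e * c
    constant i c = trans (sumOver-const (quarter i) c) (cong (_* c) (length-interval (i * e) e))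

  quarters-mono : ∀ i j {f g : ℕ → ℕ → ℕ} →
    (∀ {x y} → i * e < x → x ≤ i * e + e → j * e < y → y ≤ j * e + e → f x y ≤ g x y) →
    (∑[ x ∈ quarter i ] ∑[ y ∈ quarter j ] f x y) ≤ (∑[ x ∈ quarter i ] ∑[ y ∈ quarter j ] g x y)
  quarters-mono i j f≤g = sumOver-monoᴬ (All.map (λ (lx , ux) →
    sumOver-monoᴬ (All.map (λ (ly , uy) → f≤g lx ux ly uy) (interval-bounds (j * e) e))) (interval-bounds (i * e) e))

  quarters≤ : ∀ i i′ j j′ → suc (i + i′) ≡ 4 → suc (j + j′) ≡ 4 → ∀ (f : ℕ → ℕ → ℕ) →
    (∑[ x ∈ quarter i ] ∑[ y ∈ quarter j ] f x y) ≤ (∑[ x ∈ interval 0 d ] ∑[ y ∈ interval 0 d ] f x y)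
  quarters≤ i i′ j j′ eq eq′ f = ≤-trans (sumOver-mono (quarter i) (λ x → sumOver-quarter j j′ eq′ (f x)))
                                         (sumOver-quarter i i′ eq _)

dice-valid : ∀ n → All (λ A → length A ≡ n) (dice n)
dice-valid n = Allₚ.filter⁺ (balanced? n) (All.map proj₁ (sequences-valid n n))

-- From anticoncentration to the number of ties

module _ (K′ e ρ : ℕ) (e-large : Anticoncentration.threshold K′ ≤ e) (ρ≤8e : ρ ≤ 8 * e) where

  open Anticoncentration K′ using (K)

  private
    d = 4 * e
    n = d + (d + ρ)
    D = diceCount n

  concentrated : ∀ (G : ℕ → ℕ) t → e * e ≤ 2 * active d G → K * (∑[ B ∈ dice n ] ⟦ sumOver B G ≟ t ⟧) ≤ 2 * D
  concentrated G t = Anticoncentration.anticoncentration K′ e ρ e-large ρ≤8e G t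

  -- With `x` in the second and `y` in the fourth quarter, every `u` of the third and `v` of the
  -- first satisfies `v < x < u < y`. This gives `e²` active pairs by `balance-exchange`.
  balance-active : ∀ {x y} → 1 * e < x → x ≤ 1 * e + e → 3 * e < y → y ≤ 3 * e + e → e * e ≤ 2 * active d (balance d x y)
  balance-active {x} {y} lx ux ly uy = begin
    e * e                                          ≡⟨ trans (quarters-const e 2 0 1) (*-identityʳ (e * e)) ⟨
    (∑[ u ∈ quarter e 2 ] ∑[ v ∈ quarter e 0 ] 1)   ≤⟨ quarters-mono e 2 0 unequal ⟩
    (∑[ u ∈ quarter e 2 ] ∑[ v ∈ quarter e 0 ] ⟦ ¬? (G u + G (d + v) ≟ G (d + u) + G v) ⟧)
      ≤⟨ quarters≤ e 2 1 0 3 refl refl _ ⟩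
    active d G                                       ≤⟨ m≤n*m (active d G) 2 ⟩
    2 * active d G                                   ∎
    where
    open ≤-Reasoning
    G = balance d x y
    next : ∀ i → i * e + e ≡ suc i * e
    next i = +-comm (i * e) e
    unequal : ∀ {u v} → 2 * e < u → u ≤ 2 * e + e → 0 * e < v → v ≤ 0 * e + e →
      1 ≤ ⟦ ¬? (G u + G (d + v) ≟ G (d + u) + G v) ⟧
    unequal {u} {v} lu uu lv uv = ≤-reflexive (sym (⟦⟧-true (¬? (G u + G (d + v) ≟ G (d + u) + G v))
      (balance-exchange d lv (≤-<-trans (≤-trans uv (≤-reflexive (next 0))) lx)
                          (≤-<-trans (≤-trans ux (≤-reflexive (next 1))) lu)
                          (≤-<-trans (≤-trans uu (≤-reflexive (next 2))) ly)
                          (≤-trans uy (≤-reflexive (next 3))))))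

  inactive : List ℕ → ℕ
  inactive A = ∑[ x ∈ quarter e 1 ] ∑[ y ∈ quarter e 3 ] ⟦ score A x + score A (d + y) ≟ score A (d + x) + score A y ⟧

  -- Exchange the order of summation. For fixed `(x , y)`, inactivity forces the `balance`-weight of
  -- `A` to equal `4n`, and `balance-active` permits anticoncentration for that weight.
  inactive-total : K * sumOver (dice n) inactive ≤ (e * e) * (2 * D)
  inactive-total = begin
    K * (∑[ A ∈ dice n ] ∑[ x ∈ quarter e 1 ] ∑[ y ∈ quarter e 3 ] i A x y)
      ≡⟨ cong (K *_) (trans (sumOver-swap (dice n) (quarter e 1) _)
           (sumOver-cong (quarter e 1) (λ x → sumOver-swap (dice n) (quarter e 3) _))) ⟩
    K * (∑[ x ∈ quarter e 1 ] ∑[ y ∈ quarter e 3 ] ∑[ A ∈ dice n ] i A x y)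
      ≡⟨ trans (sumOver-cong (quarter e 1) (λ x → sumOver-*ˡ (quarter e 3) K _)) (sumOver-*ˡ (quarter e 1) K _) ⟨
    (∑[ x ∈ quarter e 1 ] ∑[ y ∈ quarter e 3 ] K * (∑[ A ∈ dice n ] i A x y))
      ≤⟨ quarters-mono e 1 3 (λ {x} {y} lx ux ly uy → ≤-trans
           (*-monoʳ-≤ K (sumOver-monoᴬ (All.map (λ {A} → level x y {A}) (dice-valid n))))
           (concentrated (balance d x y) (n * 4) (balance-active lx ux ly uy))) ⟩
    (∑[ x ∈ quarter e 1 ] ∑[ y ∈ quarter e 3 ] 2 * D)
      ≡⟨ quarters-const e 1 3 (2 * D) ⟩
    (e * e) * (2 * D) ∎
    where
    open ≤-Reasoning
    i : List ℕ → ℕ → ℕ → ℕ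
    i A x y = ⟦ score A x + score A (d + y) ≟ score A (d + x) + score A y ⟧
    level : ∀ x y {A} → length A ≡ n → i A x y ≤ ⟦ sumOver A (balance d x y) ≟ n * 4 ⟧
    level x y {A} len = ⟦⟧-mono (score A x + score A (d + y) ≟ score A (d + x) + score A y)
      (sumOver A (balance d x y) ≟ n * 4)
      (λ eq → trans (balance-sum d A x y eq) (cong (_* 4) len))

  active+inactive : ∀ A → e * e ≤ active d (score A) + inactive A
  active+inactive A = begin
    e * e
      ≡⟨ trans (quarters-const e 1 3 1) (*-identityʳ (e * e)) ⟨
    (∑[ x ∈ quarter e 1 ] ∑[ y ∈ quarter e 3 ] 1)
      ≡⟨ sumOver-cong (quarter e 1) (λ x → trans (sym (sumOver-+ (quarter e 3) _ _)) (sumOver-cong (quarter e 3)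
           (λ y → trans (+-comm (off x y) (on x y)) (⟦⟧-¬ (score A x + score A (d + y) ≟ score A (d + x) + score A y))))) ⟨
    (∑[ x ∈ quarter e 1 ] (sumOver (quarter e 3) (off x) + sumOver (quarter e 3) (on x)))
      ≡⟨ sumOver-+ (quarter e 1) _ _ ⟩
    (∑[ x ∈ quarter e 1 ] ∑[ y ∈ quarter e 3 ] off x y) + inactive A
      ≤⟨ +-monoˡ-≤ (inactive A) (quarters≤ e 1 2 3 0 refl refl off) ⟩
    active d (score A) + inactive A ∎
    where
    open ≤-Reasoning
    off on : ℕ → ℕ → ℕ
    off x y = ⟦ ¬? (score A x + score A (d + y) ≟ score A (d + x) + score A y) ⟧
    on x y = ⟦ score A x + score A (d + y) ≟ score A (d + x) + score A y ⟧

  ties : List ℕ → ℕ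
  ties A = ∑[ B ∈ dice n ] ⟦ ties? (A , B) ⟧

  ties≤D : ∀ A → ties A ≤ D
  ties≤D A = ≤-trans (sumOver-mono (dice n) (λ B → ⟦⟧≤1 (ties? (A , B))))
                     (≤-reflexive (trans (sumOver-const (dice n) 1) (*-identityʳ _)))

  -- If `score A` has many active pairs, anticoncentration at `n²` gives the first term. Otherwise
  -- at least half of the `e²` test pairs are inactive, and the trivial bound `ties A ≤ D` gives the
  -- second, as in Markov's inequality. Their sum covers both cases and can be summed over `A`.
  ties-bound : ∀ {A} → length A ≡ n → (e * e) * (K * ties A) ≤ (e * e) * (2 * D) + (2 * D) * (K * inactive A)
  ties-bound {A} len with e * e ≤? 2 * active d (score A)
  ... | yes many = ≤-trans (*-monoʳ-≤ (e * e) (≤-trans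
          (*-monoʳ-≤ K (sumOver-monoᴬ (All.map (λ {B} → level {B}) (dice-valid n)))) (concentrated (score A) (n * n) many)))
        (m≤m+n _ _)
    where
    level : ∀ {B} → length B ≡ n → ⟦ ties? (A , B) ⟧ ≤ ⟦ sumOver B (score A) ≟ n * n ⟧
    level {B} len′ = ⟦⟧-mono (ties? (A , B)) (sumOver B (score A) ≟ n * n)
      (λ tie → trans (tie-score A B tie) (cong₂ _*_ len′ len))
  ... | no few = begin
    (e * e) * (K * ties A)              ≤⟨ *-mono-≤ e²≤2inactive (*-monoʳ-≤ K (ties≤D A)) ⟩
    (2 * inactive A) * (K * D)          ≡⟨ regroup (inactive A) K D ⟩
    (2 * D) * (K * inactive A)          ≤⟨ m≤n+m _ _ ⟩
    (e * e) * (2 * D) + (2 * D) * (K * inactive A) ∎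
    where
    open ≤-Reasoning
    regroup : ∀ i K D → (2 * i) * (K * D) ≡ (2 * D) * (K * i)
    regroup = solve-∀
    e²≤2inactive : e * e ≤ 2 * inactive A
    e²≤2inactive = +-cancelˡ-≤ (e * e) _ _ (begin
      e * e + e * e                                ≡⟨ cong (e * e +_) (+-identityʳ (e * e)) ⟨
      2 * (e * e)                                  ≤⟨ *-monoʳ-≤ 2 (active+inactive A) ⟩
      2 * (active d (score A) + inactive A)          ≡⟨ *-distribˡ-+ 2 (active d (score A)) (inactive A) ⟩
      2 * active d (score A) + 2 * inactive A        ≤⟨ +-monoˡ-≤ (2 * inactive A) (<⇒≤ (≰⇒> few)) ⟩
      e * e + 2 * inactive A                       ∎)

  tieCount-bound : K * tieCount n ≤ 6 * (D * D)
  tieCount-bound = *-cancelˡ-≤ (e * e) {{m*n≢0 e e {{e≢0}} {{e≢0}}}} (begin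
    (e * e) * (K * tieCount n)
      ≡⟨ cong (λ z → (e * e) * (K * z)) (trans (length-filter-sumOver ties? (cartesianProduct (dice n) (dice n)))
           (sumOver-cartesianProduct (dice n) (dice n) (λ p → ⟦ ties? p ⟧))) ⟩
    (e * e) * (K * sumOver (dice n) ties)
      ≡⟨ trans (sumOver-*ˡ (dice n) (e * e) _) (cong (e * e *_) (sumOver-*ˡ (dice n) K ties)) ⟨
    (∑[ A ∈ dice n ] (e * e) * (K * ties A))
      ≤⟨ sumOver-monoᴬ (All.map (λ {A} → ties-bound {A}) (dice-valid n)) ⟩
    (∑[ A ∈ dice n ] ((e * e) * (2 * D) + (2 * D) * (K * inactive A)))
      ≡⟨ trans (sumOver-+ (dice n) (λ _ → (e * e) * (2 * D)) (λ A → (2 * D) * (K * inactive A)))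
           (cong₂ _+_ (sumOver-const (dice n) _)
           (trans (sumOver-*ˡ (dice n) (2 * D) _) (cong (2 * D *_) (sumOver-*ˡ (dice n) K inactive)))) ⟩
    D * ((e * e) * (2 * D)) + (2 * D) * (K * sumOver (dice n) inactive)
      -- Apart from the factor `e²`, the typical dice contribute `2 D²` and the exceptional ones
      -- `2 D · 2 D`, which makes `6 D²`.
      ≤⟨ +-monoʳ-≤ (D * ((e * e) * (2 * D))) (*-monoʳ-≤ (2 * D) inactive-total) ⟩
    D * ((e * e) * (2 * D)) + (2 * D) * ((e * e) * (2 * D))
      ≡⟨ collect (e * e) D ⟩
    (e * e) * (6 * (D * D)) ∎)
    where
    open ≤-Reasoning
    e≢0 : NonZero e
    e≢0 = >-nonZero (≤-trans (s≤s z≤n) e-large)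
    collect : ∀ s D → D * (s * (2 * D)) + (2 * D) * (s * (2 * D)) ≡ s * (6 * (D * D))
    collect = solve-∀

diceCount>0 : ∀ n → 0 < n → 0 < diceCount n
diceCount>0 n 0<n with halving n
... | h , n-parity = n≢0⇒n>0 (λ D≡0 → contradiction
  (≤-trans (m^n>0 n {{>-nonZero 0<n}} (h * 2)) (≤-trans (diceCount-lower n h n-parity)
    (≤-reflexive (trans (cong (suc (h * n) *_) D≡0) (*-zeroʳ (suc (h * n))))))) λ ())

theorem1p4 : (k : ℕ) → ∃[ N ] ((n : ℕ) → N ≤ n →
    suc k * tieCount n < diceCount n * diceCount n)
theorem1p4 k = threshold * 8 , bound
  where
  -- This makes `K = 7 (k + 1)`. Since 7 exceeds the constant 6 of `tieCount-bound` and there is at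
  -- least one die, the final inequality is strict.
  open Anticoncentration (6 + 7 * k) using (threshold)
  seven : ∀ k t → suc (6 + 7 * k) * t ≡ 7 * (suc k * t)
  seven = solve-∀
  strict : ∀ t D → 0 < D → 7 * (suc k * t) ≤ 6 * (D * D) → suc k * t < D * D
  strict t D 0<D le = *-cancelˡ-< 7 _ _ (≤-<-trans le (m<n+m (6 * (D * D)) {D * D} (*-mono-≤ 0<D 0<D)))
  decompose : ∀ r e → r + e * 8 ≡ 4 * e + (4 * e + r)
  decompose = solve-∀
  bound : ∀ n → threshold * 8 ≤ n → suc k * tieCount n < diceCount n * diceCount n
  bound n N≤n = strict (tieCount n) (diceCount n) (diceCount>0 n (≤-trans (s≤s z≤n) N≤n))
    (subst₂ _≤_ (seven k (tieCount n)) refl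
      -- Here `e = n / 8` and `ρ = n % 8`, so `n` is `4e + (4e + ρ)`.
      (subst (λ m → suc (6 + 7 * k) * tieCount m ≤ 6 * (diceCount m * diceCount m))
        (sym (trans (m≡m%n+[m/n]*n n 8) (decompose (n % 8) (n / 8))))
        (tieCount-bound (6 + 7 * k) (n / 8) (n % 8) e-large ρ≤8e)))
    where
    e-large : threshold ≤ n / 8
    e-large = ≤-trans (≤-reflexive (sym (m*n/n≡m threshold 8))) (/-monoˡ-≤ 8 N≤n)
    ρ≤8e : n % 8 ≤ 8 * (n / 8)
    ρ≤8e = ≤-trans (<⇒≤ (m%n<n n 8)) (m≤m*n 8 (n / 8) {{>-nonZero (≤-trans (s≤s z≤n) e-large)}})
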